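{- Let $Q$ be a quadrangulation with $n$ vertices and a strong labeling, with special vertices $s_0,s_1$, induced trees $T_0,T_1$ and numbers $f_0,f_1$ as defined in the context. Place the vertices of $Q$ on a horizontal line in increasing order of $f_1$ (the values $f_1(v)$ are pairwise distinct), naming them $v_1,\dots,v_n$ from left to right, draw the edges of $T_0$ as arcs in the upper half-plane and the edges of $T_1$ as arcs in the lower half-plane. Then for each $i\in\{0,1\}$, $T_i$ is non-crossing (there are no two edges $v_av_c$, $v_bv_d$ of $T_i$ with $a<b<c<d$) and alternating (there are no two edges $v_iv_j$ and $v_jv_k$ of the tree with $i<j<k$; equivalently, for every vertex $v_j$, either all its neighbors in the tree have indices larger than $j$ or all have indices smaller than $j$).
   Context: A quadrangulation is a plane graph that is a maximal bipartite plane graph; every face, including the outer face, is bounded by a 4-cycle. Its vertices are properly 2-colored black and white. An angle is a corner of a face at a vertex; each edge $uv$ has four incident angles (two at $u$ and two at $v$, one on each side of the edge). A strong labeling of $Q$ is a map from the angles to $\{0,1\}$ such that: (G0) the two black vertices on the outer face are named $s_0,s_1$ and all angles at $s_i$ are labeled $i$; (G1) for each vertex $v\notin\{s_0,s_1\}$ the labels around $v$ form a non-empty interval of 1s and a non-empty interval of 0s; (G2) for each edge, the two incident labels coincide at one endpoint and differ at the other; (G3$^+_Q$) the labels in each bounded face are $0011$ cyclically, and the labels of the outer face read clockwise starting at $s_0$ are $0011$. Each edge is colored with the label $i$ that appears twice at the endpoint where its incident labels coincide, and oriented towards that endpoint. $T_i$ denotes the set of edges of color $i$ with this orientation. $T_i$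 is a directed tree with sink $s_i$ spanning all vertices except $s_{1-i}$, and every vertex other than $s_0,s_1$ has exactly one outgoing edge in $T_0$ and one in $T_1$. For $v\notin\{s_0,s_1\}$, $P_i(v)$ is the directed path in $T_i$ from $v$ to $s_i$. The paths $P_0(v)$ and $P_1(v)$ have only $v$ in common and split $Q$ into two regions; $R_i(v)$ denotes the region to the right of $P_i(v)$ (traversed from $v$ to $s_i$), including both paths. For $v\notin\{s_0,s_1\}$, $f_i(v)$ is the number of bounded faces contained in $R_i(v)$; moreover $f_0(s_0)=f_1(s_1)=-1$ and $f_1(s_0)=f_0(s_1)=n-2$. -}

module Defs where

open import Data.Nat using (ℕ; zero; suc; _+_; _∸_; _≤_) renaming (_<_ to _<ℕ_)
open import Data.Fin using (Fin; zero; suc)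
open import Data.Bool using (Bool; true; false)
open import Data.Integer using (ℤ; +_; -1ℤ; _<_)
open import Data.List using (List; []; _∷_; length)
open import Data.List.Membership.Propositional using (_∈_)
open import Data.List.Relation.Unary.Unique.Propositional using (Unique)
open import Data.Product using (Σ; ∃; _×_; _,_)
open import Data.Sum using (_⊎_)
open import Relation.Nullary using (¬_)
open import Relation.Binary.PropositionalEquality using (_≡_; _≢_)
open import Function.Bundles using (_⇔_)

_^[_] : {A : Set} → (A → A) → ℕ → A → A
(f ^[ zero ]) x = x
(f ^[ suc k ]) x = f ((f ^[ k ]) x)

run : {A : Set} → (A → A) → (A → A) → List Bool → A → A
run s a [] d = d
run s a (true ∷ w) d = run s a w (s d)
run s a (false ∷ w) d = run s a w (a d)

-- Plane maps (connected genus-0 combinatorial maps, i.e. rotation systems)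
--
-- Darts are Fin nD.  vert d is the tail of d, α d is the reversed dart,
-- σ d is the next dart counterclockwise around vert d (σ⁻ its inverse).
-- The ANGLE (corner) indexed by dart d is the corner at vert d lying
-- counterclockwise between d and σ d (so it lies on the left of d).
-- face d is the face containing the angle d.  φ d = α (σ d) is the next
-- angle along the boundary of that face (each face is traversed with the
-- face on the right; bounded faces clockwise, the outer face
-- counterclockwise).

record PlaneMap : Set where
  field
    nV nD nE nF : ℕ
    darts-even : nD ≡ nE + nE
    vert   : Fin nD → Fin nV
    α σ σ⁻ : Fin nD → Fin nD
    face   : Fin nD → Fin nF
    α-invol : ∀ d → α (α d) ≡ d
    σσ⁻ : ∀ d → σ (σ⁻ d) ≡ d
    σ⁻σ : ∀ d → σ⁻ (σ d) ≡ d
    vert-σ : ∀ d → vert (σ d) ≡ vert d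
    vert-orbit : ∀ d d′ → vert d ≡ vert d′ → ∃ λ k → (σ ^[ k ]) d ≡ d′
    vert-surj : ∀ v → ∃ λ d → vert d ≡ v
    face-φ : ∀ d → face (α (σ d)) ≡ face d
    face-orbit : ∀ d d′ → face d ≡ face d′ →
                 ∃ λ k → ((λ e → α (σ e)) ^[ k ]) d ≡ d′
    face-surj : ∀ f → ∃ λ d → face d ≡ f
    no-loop : ∀ d → vert (α d) ≢ vert d
    no-multi : ∀ d d′ → vert d ≡ vert d′ → vert (α d) ≡ vert (α d′) → d ≡ d′
    connected : ∀ d d′ → ∃ λ (w : List Bool) → run σ α w d ≡ d′
    euler : nV + nF ≡ nE + 2

open PlaneMap public

φ : (M : PlaneMap) → Fin (nD M) → Fin (nD M)
φ M e = α M (σ M e)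

record Quadrangulation : Set where
  field
    M : PlaneMap
    outer : Fin (nF M)
    col : Fin (nV M) → Bool
    proper : ∀ d → col (vert M d) ≢ col (vert M (α M d))
    face-len4 : ∀ e → (φ M ^[ 4 ]) e ≡ e
    face-cycle : ∀ e →
      let v0 = vert M e
          v1 = vert M (φ M e)
          v2 = vert M ((φ M ^[ 2 ]) e)
          v3 = vert M ((φ M ^[ 3 ]) e)
      in v0 ≢ v1 × v0 ≢ v2 × v0 ≢ v3 × v1 ≢ v2 × v1 ≢ v3 × v2 ≢ v3

open Quadrangulation public

0F 1F : Fin 2
0F = zero
1F = suc zero

Cyc0011 : Fin 2 → Fin 2 → Fin 2 → Fin 2 → Set
Cyc0011 a b c d =
  ((a , b , c , d) ≡ (0F , 0F , 1F , 1F)) ⊎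
  ((a , b , c , d) ≡ (0F , 1F , 1F , 0F)) ⊎
  ((a , b , c , d) ≡ (1F , 1F , 0F , 0F)) ⊎
  ((a , b , c , d) ≡ (1F , 0F , 0F , 1F))

module _ (Q : Quadrangulation) where
  private
    G = M Q
    Dart = Fin (nD G)
    Vtx = Fin (nV G)

  -- Strong labeling.  a₀ is the angle of the outer face at s₀;
  -- s₀ = vert a₀ and s₁ = vert (φ² a₀) are the two black outer vertices.
  record StrongLabeling : Set where
    field
      lab : Dart → Fin 2
      a₀ : Dart
      a₀-outer : face G a₀ ≡ outer Q
      s₀-black : col Q (vert G a₀) ≡ true
      G0-s₀ : ∀ e → vert G e ≡ vert G a₀ → lab e ≡ 0F
      G0-s₁ : ∀ e → vert G e ≡ vert G ((φ G ^[ 2 ]) a₀) → lab e ≡ 1F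
      G1 : ∀ v → v ≢ vert G a₀ → v ≢ vert G ((φ G ^[ 2 ]) a₀) →
           ∃ λ d → vert G d ≡ v × ∃ λ j → ∃ λ k →
             1 ≤ j × 1 ≤ k ×
             (σ G ^[ j + k ]) d ≡ d ×
             (∀ t → 0 <ℕ t → t <ℕ j + k → (σ G ^[ t ]) d ≢ d) ×
             (∀ t → t <ℕ j → lab ((σ G ^[ t ]) d) ≡ 1F) ×
             (∀ t → j ≤ t → t <ℕ j + k → lab ((σ G ^[ t ]) d) ≡ 0F)
      -- (G2) the two angles of edge d at vert d are d and σ⁻ d
      G2 : ∀ d → (lab d ≡ lab (σ⁻ G d)) ⇔ (lab (α G d) ≢ lab (σ⁻ G (α G d)))
      G3-bounded : ∀ e → face G e ≢ outer Q →
        Cyc0011 (lab e) (lab (φ G e)) (lab ((φ G ^[ 2 ]) e)) (lab ((φ G ^[ 3 ]) e))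
      -- outer face read clockwise (i.e. along φ⁻¹ = φ³) from s₀: 0011
      G3-outer : lab a₀ ≡ 0F × lab ((φ G ^[ 3 ]) a₀) ≡ 0F ×
                 lab ((φ G ^[ 2 ]) a₀) ≡ 1F × lab (φ G a₀) ≡ 1F

  module _ (L : StrongLabeling) where
    open StrongLabeling L

    s : Fin 2 → Vtx
    s zero = vert G a₀
    s (suc _) = vert G ((φ G ^[ 2 ]) a₀)

    head : Dart → Vtx
    head d = vert G (α G d)

    -- dart d (from vert d to head d) is an edge of T_i, oriented as d:
    -- the two labels at head d coincide and equal i
    InT : Fin 2 → Dart → Set
    InT i d = lab (α G d) ≡ i × lab (σ⁻ G (α G d)) ≡ i

    EdgeT : Fin 2 → Dart → Set
    EdgeT i d = InT i d ⊎ InT i (α G d)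

    data PathT (i : Fin 2) : Vtx → List Dart → Set where
      done : PathT i (s i) []
      step : ∀ {d ds} → InT i d → PathT i (head d) ds → PathT i (vert G d) (d ∷ ds)

    OnPaths : List Dart → List Dart → Dart → Set
    OnPaths p₀ p₁ d = d ∈ p₀ ⊎ d ∈ p₁ ⊎ α G d ∈ p₀ ⊎ α G d ∈ p₁

    -- angles of bounded faces of R_1(v): region to the right of P_1(v)
    -- (= to the left of P_0(v)).  face (α d) is the face right of d,
    -- face d the face left of d.
    data InR₁ (p₀ p₁ : List Dart) : Dart → Set where
      seed₁ : ∀ {d} → d ∈ p₁ → face G (α G d) ≢ outer Q → InR₁ p₀ p₁ (α G d)
      seed₀ : ∀ {d} → d ∈ p₀ → face G d ≢ outer Q → InR₁ p₀ p₁ d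
      walk : ∀ {e} → InR₁ p₀ p₁ e → InR₁ p₀ p₁ (φ G e)
      cross : ∀ {e} → InR₁ p₀ p₁ e → ¬ OnPaths p₀ p₁ e →
              face G (α G e) ≢ outer Q → InR₁ p₀ p₁ (α G e)

    R₁Face : List Dart → List Dart → Fin (nF G) → Set
    R₁Face p₀ p₁ f = ∃ λ e → face G e ≡ f × InR₁ p₀ p₁ e

    HasCount : (Fin (nF G) → Set) → ℕ → Set
    HasCount P k = Σ (List (Fin (nF G))) λ fs →
      Unique fs × (∀ f → f ∈ fs → P f) × (∀ f → P f → f ∈ fs) × length fs ≡ k

    IsF₁ : (Vtx → ℤ) → Set
    IsF₁ f₁ =
      f₁ (s 0F) ≡ + (nV G ∸ 2) × f₁ (s 1F) ≡ -1ℤ ×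
      (∀ v → v ≢ s 0F → v ≢ s 1F → ∀ p₀ p₁ → PathT 0F v p₀ → PathT 1F v p₁ →
        ∃ λ k → HasCount (R₁Face p₀ p₁) k × f₁ v ≡ + k)

    NonCrossing : (Vtx → ℤ) → Fin 2 → Set
    NonCrossing f i = ∀ d d′ → EdgeT i d → EdgeT i d′ →
      ¬ (f (vert G d) < f (vert G d′) × f (vert G d′) < f (head d) ×
         f (head d) < f (head d′))

    Alternating : (Vtx → ℤ) → Fin 2 → Set
    Alternating f i = ∀ d d′ → EdgeT i d → EdgeT i d′ → head d ≡ vert G d′ →
      ¬ (f (vert G d) < f (vert G d′) × f (vert G d′) < f (head d′))

{-# OPTIONS --safe #-}
module Submission where

-- The labelling rules force lab (φ e) to equal lab e or its opposite according to the colour of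
-- vert e, so a black and a white vertex see the same rule with left and right exchanged. Hence every
-- vertex v ∉ {s₀ , s₁} sends out one dart of each colour, and there is an equator, a curve separating the
-- 0-angles from the 1-angles, that passes alternately through faces and vertices, meeting each face once.
-- Going around the tree T_i it visits the descendants of any vertex consecutively, with that vertex at one
-- end of the interval; which end depends on its colour and on i. As the contours of T₀ and T₁ are the same
-- curve run in opposite directions, it visits all inner vertices. The interval of the descendants of v lies
-- between the two faces of the out-dart of v, hence R₁(v) consists of the bounded faces that precede v on
-- the equator, and f₁ numbers the vertices along it. The interval property then makes both trees
-- non-crossing, and alternating because the end at which v sits is determined by its colour.

open import Defs
open import Data.Bool using (Bool; true; false; not; if_then_else_)
open import Data.Bool.Properties using (not-involutive)
open import Data.Empty using (⊥; ⊥-elim)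
open import Data.Fin using (Fin; zero; suc; toℕ)
open import Data.Fin.Properties using (_≟_; pigeonhole; toℕ<n)
open import Data.Integer using (ℤ; -1ℤ)
import Data.Integer as ℤ
open import Data.List using (List; []; _∷_; [_]; _++_; _∷ʳ_; length; reverse)
open import Data.List.Membership.Propositional using (_∈_; _∉_)
open import Data.List.Membership.Propositional.Properties using (∈-++⁺ˡ; ∈-++⁺ʳ; ∈-++⁻; ∈-∃++; ∈-allFin)
open import Data.List.Membership.Propositional.Properties.WithK using (unique∧set⇒bag)
open import Data.List.Properties using (unfold-reverse; ++-identityʳ; ++-assoc; reverse-++; reverse-involutive; ∷-injective; length-tabulate; length-++)
open import Data.List.Relation.Binary.BagAndSetEquality using (∼bag⇒↭)
open import Data.List.Relation.Binary.Permutation.Propositional using (↭-sym; ↭⇒↭ₛ)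
open import Data.List.Relation.Binary.Permutation.Propositional.Properties using (↭-reverse; ↭-length)
open import Data.List.Relation.Binary.Permutation.Setoid.Properties using (Unique-resp-↭)
open import Data.List.Relation.Unary.All using ([]; _∷_; lookup; tabulate)
open import Data.List.Relation.Unary.AllPairs using ([]; _∷_)
open import Data.List.Relation.Unary.Any using (here; there)
import Data.List.Relation.Unary.Any.Properties as Any
open import Data.List.Relation.Unary.Unique.Propositional using (Unique)
import Data.List.Relation.Unary.Unique.Propositional.Properties as Unique
open import Data.Nat using (ℕ; zero; suc; _+_; _*_; _∸_; _≤_; _<_; z≤n; s≤s; s≤s⁻¹; NonZero; >-nonZero)
open import Data.Nat.DivMod using (_/_; _%_; m≡m%n+[m/n]*n; m%n<n)
open import Data.Nat.Properties using (+-comm; +-suc; +-identityʳ; +-assoc; ≤-refl; ≤-trans; n<1+n; n≤1+n; m≤m+n; m≤n+m; <-≤-trans; ≤-<-trans; ≤⇒≯; m+[n∸m]≡n; m<n⇒m<1+n; <⇒≤; _<?_; ≮⇒≥; +-monoʳ-<; +-monoˡ-<; +-cancelˡ-<; m≤n⇒m<n∨m≡n; m≢1+n+m; <-irrefl; <-trans; suc-injective; +-monoʳ-≤)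
open import Data.Product using (∃; _×_; _,_; proj₁; proj₂)
open import Data.Sum using (_⊎_; inj₁; inj₂)
open import Function.Bundles using (_⇔_; mk⇔; Equivalence)
open import Relation.Binary.PropositionalEquality using (_≡_; _≢_; refl; sym; trans; cong; cong₂; subst; subst₂; setoid; module ≡-Reasoning)
open import Relation.Nullary using (¬_; Dec; yes; no)

-- The definitions give each `T i` only as a set of darts, so at the start neither acyclicity nor
-- spanning is available. Subtrees are therefore explored outwards from the roots: `Depth` certifies
-- that a vertex hangs below a root, cycles are excluded for such vertices only, and connectedness
-- shows at the end that they are all the vertices. This last step needs the two contours to visit
-- the same vertices, which comes from determinism: a face and a vertex each force the next step of
-- the equator, so two closed walks without repetition from the outer face, run in the same
-- direction, agree. R₁(v) is given as a closure of seeds under walking around faces and crossing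
-- edges, so two inclusions are needed. A crossing that avoids both paths stays on the same side of
-- v on the equator; conversely, the faces before v are reached one at a time, going backwards from
-- v.

opp : Fin 2 → Fin 2
opp zero = 1F
opp (suc _) = 0F

oppIf : Bool → Fin 2 → Fin 2
oppIf true  = opp
oppIf false = λ i → i

opp-involutive : ∀ i → opp (opp i) ≡ i
opp-involutive zero = refl
opp-involutive (suc zero) = refl

opp-≢ : ∀ i → i ≢ opp i
opp-≢ zero ()
opp-≢ (suc zero) ()

≢⇒≡opp : ∀ {i j} → i ≢ j → i ≡ opp j
≢⇒≡opp {zero} {zero} ne = ⊥-elim (ne refl)
≢⇒≡opp {zero} {suc zero} ne = refl
≢⇒≡opp {suc zero} {zero} ne = refl
≢⇒≡opp {suc zero} {suc zero} ne = ⊥-elim (ne refl)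

oppIf-involutive : ∀ c i → oppIf c (oppIf c i) ≡ i
oppIf-involutive true i = opp-involutive i
oppIf-involutive false i = refl

oppIf-opp : ∀ c i → oppIf c (opp i) ≡ opp (oppIf c i)
oppIf-opp true i = refl
oppIf-opp false i = refl

oppIf-not : ∀ c i → oppIf (not c) i ≡ opp (oppIf c i)
oppIf-not true i = sym (opp-involutive i)
oppIf-not false i = refl

≢⇒not≡ : ∀ {b c} → b ≢ c → c ≡ not b
≢⇒not≡ {true} {true} ne = ⊥-elim (ne refl)
≢⇒not≡ {true} {false} ne = refl
≢⇒not≡ {false} {true} ne = refl
≢⇒not≡ {false} {false} ne = ⊥-elim (ne refl)

-- Iterates of a map.

module _ {A : Set} (f : A → A) where

  iter-+ : ∀ m n x → (f ^[ m + n ]) x ≡ (f ^[ m ]) ((f ^[ n ]) x)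
  iter-+ zero n x = refl
  iter-+ (suc m) n x = cong f (iter-+ m n x)

  iter-suc : ∀ n x → (f ^[ suc n ]) x ≡ (f ^[ n ]) (f x)
  iter-suc zero x = refl
  iter-suc (suc n) x = cong f (iter-suc n x)

  iter-mult : ∀ {p x} → (f ^[ p ]) x ≡ x → ∀ m → (f ^[ m * p ]) x ≡ x
  iter-mult eq zero = refl
  iter-mult {p} {x} eq (suc m) =
    trans (iter-+ p (m * p) x) (trans (cong (f ^[ p ]) (iter-mult eq m)) eq)

  -- Orbits come with an unbounded exponent; below the period, a face leaves four cases and a vertex
  -- the ones and zeros of (G1).
  iter-reduce : ∀ {p x} → 0 < p → (f ^[ p ]) x ≡ x → ∀ n → ∃ λ m → m < p × (f ^[ n ]) x ≡ (f ^[ m ]) x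
  iter-reduce {p} {x} 0<p eq n = n % p , m%n<n n p , (begin
      (f ^[ n ]) x                          ≡⟨ cong (λ k → (f ^[ k ]) x) (m≡m%n+[m/n]*n n p) ⟩
      (f ^[ n % p + n / p * p ]) x          ≡⟨ iter-+ (n % p) _ x ⟩
      (f ^[ n % p ]) ((f ^[ n / p * p ]) x) ≡⟨ cong (f ^[ n % p ]) (iter-mult eq (n / p)) ⟩
      (f ^[ n % p ]) x                      ∎)
    where
      open ≡-Reasoning
      instance
        p≢0 : NonZero p
        p≢0 = >-nonZero 0<p

  iter-pres : (P : A → Set) → (∀ {x} → P x → P (f x)) → ∀ n {x} → P x → P ((f ^[ n ]) x)
  iter-pres P pres zero px = px
  iter-pres P pres (suc n) px = pres (iter-pres P pres n px)

  iter-inv : ∀ {B : Set} (g : A → B) → (∀ x → g (f x) ≡ g x) → ∀ n x → g ((f ^[ n ]) x) ≡ g x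
  iter-inv g eq zero x = refl
  iter-inv g eq (suc n) x = trans (eq _) (iter-inv g eq n x)

  iter-injective : (∀ {x y} → f x ≡ f y → x ≡ y) → ∀ n {x y} → (f ^[ n ]) x ≡ (f ^[ n ]) y → x ≡ y
  iter-injective inj zero eq = eq
  iter-injective inj (suc n) eq = iter-injective inj n (inj eq)

least : ∀ {P : ℕ → Set} → (∀ n → Dec (P n)) → ∀ n → P n → ∃ λ m → P m × (∀ k → k < m → ¬ P k)
least P? n pn with P? 0
... | yes p0 = 0 , p0 , λ _ ()
least P? zero pn | no ¬p0 = ⊥-elim (¬p0 pn)
least P? (suc n) pn | no ¬p0 with least (λ k → P? (suc k)) n pn
... | m , pm , below = suc m , pm , λ { zero _ → ¬p0 ; (suc k) (s≤s k<m) → below k k<m }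

Cyc0011-rotate : ∀ {a b c d} → Cyc0011 a b c d → Cyc0011 b c d a
Cyc0011-rotate (inj₁ refl) = inj₂ (inj₁ refl)
Cyc0011-rotate (inj₂ (inj₁ refl)) = inj₂ (inj₂ (inj₁ refl))
Cyc0011-rotate (inj₂ (inj₂ (inj₁ refl))) = inj₂ (inj₂ (inj₂ refl))
Cyc0011-rotate (inj₂ (inj₂ (inj₂ refl))) = inj₁ refl

-- Around 0011 the labels repeat and change in turn, just as the colours alternate around a face.
Cyc0011-alternates : ∀ {a b c d} x → Cyc0011 a b c d → b ≡ oppIf x a → c ≡ oppIf (not x) b
Cyc0011-alternates true (inj₂ (inj₁ refl)) eq = refl
Cyc0011-alternates true (inj₂ (inj₂ (inj₂ refl))) eq = refl
Cyc0011-alternates false (inj₁ refl) eq = refl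
Cyc0011-alternates false (inj₂ (inj₂ (inj₁ refl))) eq = refl
Cyc0011-alternates true (inj₁ refl) ()
Cyc0011-alternates true (inj₂ (inj₂ (inj₁ refl))) ()
Cyc0011-alternates false (inj₂ (inj₁ refl)) ()
Cyc0011-alternates false (inj₂ (inj₂ (inj₂ refl))) ()

-- Lists without repetition and positions in them.

unique-disjoint : ∀ {A : Set} {xs ys : List A} {x} → Unique (xs ++ ys) → x ∈ xs → x ∉ ys
unique-disjoint {xs = _ ∷ xs} (fresh ∷ _) (here refl) x∈ys = lookup fresh (∈-++⁺ʳ xs x∈ys) refl
unique-disjoint (_ ∷ u) (there x∈xs) = unique-disjoint u x∈xs

prefix-before : ∀ {A : Set} xs {ys as : List A} {v bs} → xs ++ ys ≡ as ++ v ∷ bs → v ∉ xs →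
  ∃ λ cs → as ≡ xs ++ cs × ys ≡ cs ++ v ∷ bs
prefix-before [] {as = as} eq _ = as , refl , eq
prefix-before (x ∷ xs) {as = []} refl v∉ = ⊥-elim (v∉ (here refl))
prefix-before (x ∷ xs) {as = a ∷ as} eq v∉ with ∷-injective eq
... | refl , eq′ with prefix-before xs eq′ (λ v∈ → v∉ (there v∈))
...   | cs , refl , q = cs , refl , q

-- Without repetition, the occurrence of `v` in `xs` has to be the displayed one, so `xs` reaches
-- past `as`.
prefix-after : ∀ {A : Set} {xs ys as : List A} {v bs} → Unique (xs ++ ys) → xs ++ ys ≡ as ++ v ∷ bs → v ∈ xs →
  ∃ λ cs → xs ≡ as ++ v ∷ cs
prefix-after {xs = xs} {ys} {as} {v} {bs} u eq v∈ with ∈-∃++ v∈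
... | us , cs , refl with prefix-before us (trans (sym (++-assoc us (v ∷ cs) ys)) eq)
                         (λ v∈us → unique-disjoint (subst Unique (++-assoc us (v ∷ cs) ys) u) v∈us (here refl))
...   | [] , refl , _ = cs , cong (_++ v ∷ cs) (sym (++-identityʳ us))
...   | x ∷ ds , refl , q with ∷-injective q
...     | refl , _ = ⊥-elim (unique-disjoint (subst Unique eq u) (∈-++⁺ʳ us (here refl)) (here refl))

unique-prefix : ∀ {A : Set} (xs : List A) {ys} → Unique (xs ++ ys) → Unique xs
unique-prefix [] _ = []
unique-prefix (x ∷ xs) (fresh ∷ u) = tabulate (λ y∈ → lookup fresh (∈-++⁺ˡ y∈)) ∷ unique-prefix xs u

unique-length : ∀ {A : Set} {xs ys : List A} → Unique xs → Unique ys →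
  (∀ {x} → x ∈ xs → x ∈ ys) → (∀ {x} → x ∈ ys → x ∈ xs) → length xs ≡ length ys
unique-length ux uy to from = ↭-length (∼bag⇒↭ (unique∧set⇒bag ux uy (mk⇔ to from)))

position : ∀ {n} → List (Fin n) → Fin n → ℕ
position [] v = 0
position (x ∷ xs) v with v ≟ x
... | yes _ = 0
... | no _ = suc (position xs v)

position-++ˡ : ∀ {n} {v : Fin n} xs {ys} → v ∈ xs → position (xs ++ ys) v < length xs
position-++ˡ {v = v} (x ∷ xs) v∈ with v ≟ x
... | yes _ = s≤s z≤n
position-++ˡ (x ∷ xs) (here eq) | no ne = ⊥-elim (ne eq)
position-++ˡ (x ∷ xs) (there v∈) | no _ = s≤s (position-++ˡ xs v∈)

position-++ʳ : ∀ {n} {v : Fin n} xs {ys} → v ∉ xs → position (xs ++ ys) v ≡ length xs + position ys v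
position-++ʳ [] v∉ = refl
position-++ʳ {v = v} (x ∷ xs) v∉ with v ≟ x
... | yes eq = ⊥-elim (v∉ (here eq))
... | no _ = cong suc (position-++ʳ xs (λ v∈ → v∉ (there v∈)))

position-here : ∀ {n} {v : Fin n} {xs} → position (v ∷ xs) v ≡ 0
position-here {v = v} with v ≟ v
... | yes _ = refl
... | no ne = ⊥-elim (ne refl)

position-middle : ∀ {n} {v : Fin n} xs {ys} → v ∉ xs → position (xs ++ v ∷ ys) v ≡ length xs
position-middle xs v∉ = trans (position-++ʳ xs v∉) (trans (cong (length xs +_) position-here) (+-identityʳ _))

position-injective : ∀ {n} {u v : Fin n} xs → u ∈ xs → v ∈ xs → position xs u ≡ position xs v → u ≡ v
position-injective {u = u} {v} (x ∷ xs) u∈ v∈ eq with u ≟ x | v ≟ x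
... | yes refl | yes refl = refl
position-injective (x ∷ xs) u∈ v∈ () | yes _ | no _
position-injective (x ∷ xs) u∈ v∈ () | no _ | yes _
position-injective (x ∷ xs) (here eq) v∈ _ | no ne | no _ = ⊥-elim (ne eq)
position-injective (x ∷ xs) (there _) (here eq) _ | no _ | no ne = ⊥-elim (ne eq)
position-injective (x ∷ xs) (there u∈) (there v∈) eq | no _ | no _ = position-injective xs u∈ v∈ (suc-injective eq)

-- The shift from the place in the left-to-right order to f₁: place 0 belongs to s₁, whose value is
-- -1.
predℤ : ℕ → ℤ
predℤ zero = -1ℤ
predℤ (suc n) = ℤ.+ n

predℤ-injective : ∀ {m n} → predℤ m ≡ predℤ n → m ≡ n
predℤ-injective {zero} {zero} _ = refl
predℤ-injective {suc m} {suc .m} refl = refl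

predℤ-cancel-< : ∀ {m n} → predℤ m ℤ.< predℤ n → m < n
predℤ-cancel-< {zero} {zero} (ℤ.-<- ())
predℤ-cancel-< {zero} {suc n} _ = s≤s z≤n
predℤ-cancel-< {suc m} {suc n} (ℤ.+<+ lt) = s≤s lt

-- The labelling along faces and across edges.

module Labeled (Q : Quadrangulation) (L : StrongLabeling Q) where
  open StrongLabeling L

  G = M Q
  Dart = Fin (nD G)
  Vtx = Fin (nV G)
  Face = Fin (nF G)

  rot rot⁻ rev nxt : Dart → Dart
  rot = σ G
  rot⁻ = σ⁻ G
  rev = α G
  nxt = φ G

  src tgt : Dart → Vtx
  src = vert G
  tgt d = vert G (rev d)

  fc : Dart → Face
  fc = face G

  black : Dart → Bool
  black d = col Q (src d)

  root : Fin 2 → Vtx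
  root = s Q L

  T : Fin 2 → Dart → Set
  T = InT Q L

  src-rot⁻ : ∀ d → src (rot⁻ d) ≡ src d
  src-rot⁻ d = trans (sym (vert-σ G (rot⁻ d))) (cong src (σσ⁻ G d))

  src-iter : ∀ n d → src ((rot ^[ n ]) d) ≡ src d
  src-iter = iter-inv rot src (vert-σ G)

  rot-injective : ∀ {d e} → rot d ≡ rot e → d ≡ e
  rot-injective eq = trans (sym (σ⁻σ G _)) (trans (cong rot⁻ eq) (σ⁻σ G _))

  rev-injective : ∀ {d e} → rev d ≡ rev e → d ≡ e
  rev-injective eq = trans (sym (α-invol G _)) (trans (cong rev eq) (α-invol G _))

  nxt-rot⁻ : ∀ d → nxt (rot⁻ d) ≡ rev d
  nxt-rot⁻ d = cong rev (σσ⁻ G d)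

  fc-rot⁻ : ∀ d → fc (rot⁻ d) ≡ fc (rev d)
  fc-rot⁻ d = trans (sym (face-φ G (rot⁻ d))) (cong fc (nxt-rot⁻ d))

  black-rev : ∀ d → black (rev d) ≡ not (black d)
  black-rev d = ≢⇒not≡ (proper Q d)

  black-nxt : ∀ d → black (nxt d) ≡ not (black d)
  black-nxt d = trans (black-rev (rot d)) (cong (λ v → not (col Q v)) (vert-σ G d))

  Cyclic : Dart → Set
  Cyclic e = Cyc0011 (lab e) (lab (nxt e)) (lab ((nxt ^[ 2 ]) e)) (lab ((nxt ^[ 3 ]) e))

  cyclic-nxt : ∀ {e} → Cyclic e → Cyclic (nxt e)
  cyclic-nxt {e} c rewrite face-len4 Q e = Cyc0011-rotate c

  cyclic-a₀ : Cyclic a₀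
  cyclic-a₀ with G3-outer
  ... | p , q , r , t rewrite p | q | r | t = inj₂ (inj₁ refl)

  cyclic : ∀ e → Cyclic e
  cyclic e with fc e ≟ outer Q
  ... | no ne = G3-bounded e ne
  ... | yes eq with face-orbit G a₀ e (trans a₀-outer (sym eq))
  ...   | k , refl = iter-pres nxt Cyclic (λ {x} → cyclic-nxt {x}) k {a₀} cyclic-a₀

  -- Propagates along a face by the cyclic pattern 0011 and across an edge by G2.
  Flow : Dart → Set
  Flow e = lab (nxt e) ≡ oppIf (black e) (lab e)

  flow-nxt : ∀ {e} → Flow e → Flow (nxt e)
  flow-nxt {e} fl = subst (λ c → lab (nxt (nxt e)) ≡ oppIf c (lab (nxt e))) (sym (black-nxt e))
    (Cyc0011-alternates (black e) (cyclic e) fl)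

  -- The left and right labels of a dart are `l`, `r` at its tail and `l′`, `r′` at its head. By
  -- (G2) they coincide at exactly one end, so their sum is odd: the label changes along one side of
  -- the dart exactly if it does not along the other.
  flow-across : ∀ c {l r l′ r′ : Fin 2} → l ≡ oppIf (not c) l′ → (l ≡ r) ⇔ (r′ ≢ l′) → r′ ≡ oppIf c r
  flow-across c {l} {r} {l′} {r′} eq iff with l ≟ r
  ... | yes refl = trans (≢⇒≡opp (Equivalence.to iff refl)) (sym (trans (cong (oppIf c) (trans eq (oppIf-not c l′)))
                     (trans (oppIf-opp c _) (cong opp (oppIf-involutive c l′)))))
  ... | no ne with r′ ≟ l′
  ...   | no ne′ = ⊥-elim (ne (Equivalence.from iff ne′))
  ...   | yes refl = sym (trans (cong (oppIf c) (trans (≢⇒≡opp (λ q → ne (sym q)))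
                       (trans (cong opp (trans eq (oppIf-not c r′))) (opp-involutive _)))) (oppIf-involutive c r′))

  flow-rev : ∀ {d} → Flow d → Flow (rev d)
  flow-rev {d} fl = subst Flow (nxt-rot⁻ d) (flow-nxt {rot⁻ d} at-right)
    where
      before-d : nxt (rot⁻ (rev d)) ≡ d
      before-d = trans (nxt-rot⁻ (rev d)) (α-invol G d)

      -- The angle before `d` in its face is also three steps after it, so `Flow` reaches it. This
      -- is the rule along the left side of `d`.
      at-left : lab d ≡ oppIf (not (black d)) (lab (rot⁻ (rev d)))
      at-left = subst₂ (λ x c → lab x ≡ oppIf c (lab (rot⁻ (rev d)))) before-d
        (trans (cong (col Q) (src-rot⁻ (rev d))) (black-rev d))
        (subst Flow (trans (sym (cong (nxt ^[ 3 ]) before-d)) (face-len4 Q (rot⁻ (rev d))))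
          (iter-pres nxt Flow (λ {x} → flow-nxt {x}) 3 fl))

      at-right : Flow (rot⁻ d)
      at-right = subst₂ (λ x c → lab x ≡ oppIf c (lab (rot⁻ d))) (sym (nxt-rot⁻ d))
        (sym (cong (col Q) (src-rot⁻ d)))
        (flow-across (black d) at-left (G2 d))

  flow-rot : ∀ {d} → Flow d → Flow (rot d)
  flow-rot {d} fl = subst Flow (α-invol G (rot d)) (flow-rev (flow-nxt fl))

  flow : ∀ e → Flow e
  flow e with connected G a₀ e
  ... | w , refl = go w flow-a₀
    where
      go : ∀ w {d} → Flow d → Flow (run rot rev w d)
      go [] fl = fl
      go (true ∷ w) fl = go w (flow-rot fl)
      go (false ∷ w) fl = go w (flow-rev fl)

      -- In the direction of `nxt` the outer face reads 0110: the change after the black `s₀`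
      -- decides which colour carries the changes.
      flow-a₀ : Flow a₀
      flow-a₀ with G3-outer
      ... | p , _ , _ , q rewrite p | q | s₀-black = refl

  lab-rev : ∀ d → lab (rev d) ≡ oppIf (black d) (lab (rot⁻ d))
  lab-rev d = subst₂ (λ x c → lab x ≡ oppIf c (lab (rot⁻ d))) (nxt-rot⁻ d) (cong (col Q) (src-rot⁻ d)) (flow (rot⁻ d))

  lab-rot⁻-rev : ∀ d → lab (rot⁻ (rev d)) ≡ oppIf (not (black d)) (lab d)
  lab-rot⁻-rev d = sym (trans (cong₂ oppIf (sym (black-rev d)) (trans (cong lab (sym (α-invol G d))) (lab-rev (rev d))))
    (oppIf-involutive (black (rev d)) _))

  -- Label changes around a vertex and the faces beside them.

  Turn : Fin 2 → Dart → Set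
  Turn i d = lab d ≡ i × lab (rot⁻ d) ≡ opp i

  -- For a dart out of a black vertex, the labels at its two ends agree on the left side and differ
  -- on the right; for a white one it is the reverse. So, counterclockwise, the out-dart of colour
  -- `i` opens the `i`-angles of a black vertex and closes those of a white one.
  T⇒Turn : ∀ {i d} → T i d → Turn (oppIf (not (black d)) i) d
  T⇒Turn {i} {d} (p , q) =
    trans (sym (oppIf-involutive c′ (lab d))) (cong (oppIf c′) (trans (sym (lab-rot⁻-rev d)) q)) ,
    trans (sym (oppIf-involutive c (lab (rot⁻ d))))
      (trans (cong (oppIf c) (trans (sym (lab-rev d)) p)) 
        (trans (sym (opp-involutive _)) (cong opp (sym (oppIf-not c i)))))
    where c = black d ; c′ = not (black d)

  Turn⇒T : ∀ {i d} → Turn i d → T (oppIf (not (black d)) i) d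
  Turn⇒T {i} {d} (p , q) =
    trans (lab-rev d) (trans (cong (oppIf c) q) (trans (oppIf-opp c i) (sym (oppIf-not c i)))) ,
    trans (lab-rot⁻-rev d) (cong (oppIf (not c)) p)
    where c = black d

  Turn-rev : ∀ {i j d} → Turn i d → ¬ Turn j (rev d)
  Turn-rev {i} {j} {d} t (p , q) with Turn⇒T t
  ... | p′ , q′ = opp-≢ j (trans (trans (sym p) p′) (trans (sym q′) q))

  lab-root : ∀ i {d} → src d ≡ root i → lab d ≡ i
  lab-root zero = G0-s₀ _
  lab-root (suc zero) = G0-s₁ _

  black-root : ∀ i → col Q (root i) ≡ true
  black-root zero = s₀-black
  black-root (suc zero) = trans (black-nxt (nxt a₀)) (trans (cong not (black-nxt a₀)) (trans (not-involutive _) s₀-black))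

  Turn-inner : ∀ {i d} → Turn i d → ∀ j → src d ≢ root j
  Turn-inner {i} {d} (p , q) j eq =
    opp-≢ i (trans (sym p) (trans (lab-root j eq) (trans (sym (lab-root j (trans (src-rot⁻ d) eq))) q)))

  -- There are `len + 1` angles in the run, so `len` counts the darts with label `i` on both sides
  -- at `v`. These are the ones along which children are attached.
  record Run (i : Fin 2) (v : Vtx) : Set where
    field
      first : Dart
      len : ℕ
      at : src first ≡ v
      before : lab (rot⁻ first) ≡ opp i
      during : ∀ t → t ≤ len → lab ((rot ^[ t ]) first) ≡ i
      after : lab (rot ((rot ^[ len ]) first)) ≡ opp i
      complete : ∀ e → src e ≡ v → lab e ≡ i → ∃ λ t → t ≤ len × (rot ^[ t ]) first ≡ e

    first-turn : Turn i first
    first-turn = during 0 z≤n , before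

    last-turn : Turn (opp i) (rot ((rot ^[ len ]) first))
    last-turn = after , trans (cong lab (σ⁻σ G _)) (trans (during len ≤-refl) (sym (opp-involutive i)))

    src-at : ∀ t → src ((rot ^[ t ]) first) ≡ v
    src-at t = trans (src-iter t first) at

    no-return : ∀ t → suc t ≤ len → (rot ^[ suc t ]) first ≢ first
    no-return t le eq = opp-≢ i (trans (sym (during t (<⇒≤ le)))
      (trans (cong lab (trans (sym (σ⁻σ G _)) (cong rot⁻ eq))) before))

    turn-first : ∀ {e} → src e ≡ v → Turn i e → first ≡ e
    turn-first {e} at-v (p , q) with complete e at-v p
    ... | zero , _ , refl = refl
    ... | suc t , le , refl = ⊥-elim (opp-≢ i (trans (sym (during t (<⇒≤ le))) (trans (cong lab (sym (σ⁻σ G _))) q)))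

  opaque
    run-at : ∀ i v → (∀ j → v ≢ root j) → Run i v
    run-at i v inner with G1 v (inner 0F) (inner 1F)
    ... | d , at , suc j , suc k , _ , _ , period , _ , ones , zeros = r i
      where
        orbit : ∀ e → src e ≡ v → ∃ λ t → t < suc j + suc k × (rot ^[ t ]) d ≡ e
        orbit e eq with vert-orbit G d e (trans at (sym eq))
        ... | n , refl with iter-reduce rot {suc j + suc k} (s≤s z≤n) period n
        ...   | m , m<p , q = m , m<p , sym q

        r : ∀ i → Run i v
        r (suc zero) = record
          { first = d ; len = j ; at = at
          ; before = trans (cong lab (trans (cong rot⁻ (sym period)) (σ⁻σ G _)))
              (zeros (j + suc k) (subst (suc j ≤_) (sym (+-suc j k)) (s≤s (m≤m+n j k))) (n<1+n _))
          ; during = λ t le → ones t (s≤s le)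
          ; after = zeros (suc j) ≤-refl (s≤s (subst (suc j ≤_) (sym (+-suc j k)) (s≤s (m≤m+n j k))))
          ; complete = λ e eq le → find e eq le (orbit e eq)
          }
          where
            find : ∀ e → src e ≡ v → lab e ≡ 1F → (∃ λ t → t < suc j + suc k × (rot ^[ t ]) d ≡ e) →
                   ∃ λ t → t ≤ j × (rot ^[ t ]) d ≡ e
            find e eq le (t , t<p , refl) with t <? suc j
            ... | yes (s≤s t≤j) = t , t≤j , refl
            ... | no t≮ with trans (sym le) (zeros t (≮⇒≥ t≮) t<p)
            ...   | ()
        r zero = record
          { first = (rot ^[ suc j ]) d ; len = k ; at = trans (src-iter (suc j) d) at
          ; before = trans (cong lab (σ⁻σ G _)) (ones j (n<1+n j))
          ; during = λ t le → trans (cong lab (shift t))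
              (zeros (t + suc j) (m≤n+m (suc j) t) (subst (t + suc j <_) (+-comm (suc k) (suc j)) (+-monoˡ-< (suc j) (s≤s le))))
          ; after = trans (cong lab (trans (shift (suc k)) (trans (cong (λ n → (rot ^[ n ]) d) (+-comm (suc k) (suc j))) period))) (ones 0 (s≤s z≤n))
          ; complete = λ e eq le → find e eq le (orbit e eq)
          }
          where
            shift : ∀ t → (rot ^[ t ]) ((rot ^[ suc j ]) d) ≡ (rot ^[ t + suc j ]) d
            shift t = sym (iter-+ rot t (suc j) d)
            find : ∀ e → src e ≡ v → lab e ≡ 0F → (∃ λ t → t < suc j + suc k × (rot ^[ t ]) d ≡ e) →
                   ∃ λ t → t ≤ k × (rot ^[ t ]) ((rot ^[ suc j ]) d) ≡ e
            find e eq le (t , t<p , refl) with t <? suc j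
            ... | yes t<j with trans (sym le) (ones t t<j)
            ...   | ()
            find e eq le (t , s≤s t<p , refl) | no t≮ = t ∸ suc j , small , trans (shift (t ∸ suc j)) (cong (λ n → (rot ^[ n ]) d) t-eq)
              where
                t-eq : t ∸ suc j + suc j ≡ t
                t-eq = trans (+-comm (t ∸ suc j) (suc j)) (m+[n∸m]≡n (≮⇒≥ t≮))
                small : t ∸ suc j ≤ k
                small with +-cancelˡ-< (suc j) (t ∸ suc j) (suc k) (subst (_< suc j + suc k) (sym (m+[n∸m]≡n (≮⇒≥ t≮))) (s≤s t<p))
                ... | s≤s le = le

  Turn-unique : ∀ {i d e} → src d ≡ src e → Turn i d → Turn i e → d ≡ e
  Turn-unique {i} {d} {e} eq td te = trans (sym (turn-first refl td)) (turn-first (sym eq) te)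
    where open Run (run-at i (src d) (Turn-inner td))

  T-inner : ∀ {i d} → T i d → ∀ j → src d ≢ root j
  T-inner {i} {d} t = Turn-inner (T⇒Turn {i} {d} t)

  T-unique : ∀ {i d e} → src d ≡ src e → T i d → T i e → d ≡ e
  T-unique {i} {d} {e} eq td te = Turn-unique eq (T⇒Turn td)
    (subst (λ v → Turn (oppIf (not (col Q v)) i) e) (sym eq) (T⇒Turn te))

  -- At a turn the equator runs through the face in which the labels at the two ends of the dart differ.
  side : Dart → Face
  side d = if black d then fc (rev d) else fc d

  side-black : ∀ {d} → black d ≡ true → side d ≡ fc (rev d)
  side-black eq rewrite eq = refl

  side-white : ∀ {d} → black d ≡ false → side d ≡ fc d
  side-white eq rewrite eq = refl

  -- For each `i` this matches inner vertices injectively with faces (`Hit-face`, `Hit-vertex`); the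
  -- equator uses the two matchings in turn.
  Hit : Fin 2 → Vtx → Face → Set
  Hit i v f = ∃ λ d → src d ≡ v × Turn i d × side d ≡ f

  Hit-inner : ∀ {i v f} → Hit i v f → ∀ j → v ≢ root j
  Hit-inner (d , refl , t , _) = Turn-inner t

  Hit-face : ∀ {i v f g} → Hit i v f → Hit i v g → f ≡ g
  Hit-face (d , refl , t , refl) (e , eq , u , refl) = cong side (Turn-unique (sym eq) t u)

  -- Each face has exactly one white angle of either label, so a turn is determined by its side.
  white-end : Dart → Dart
  white-end d = if black d then rev d else d

  white-end-white : ∀ d → black (white-end d) ≡ false
  white-end-white d with black d in eq
  ... | true = trans (black-rev d) (cong not eq)
  ... | false = eq

  white-end-face : ∀ d → fc (white-end d) ≡ side d
  white-end-face d with black d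
  ... | true = refl
  ... | false = refl

  white-end-lab : ∀ {i} d → Turn i d → lab (white-end d) ≡ i
  white-end-lab {i} d (p , q) with black d in eq
  ... | false = p
  ... | true = trans (lab-rev d) (trans (cong (λ c → oppIf c (lab (rot⁻ d))) eq) (trans (cong opp q) (opp-involutive i)))

  white-end-either : ∀ d → white-end d ≡ d ⊎ white-end d ≡ rev d
  white-end-either d with black d
  ... | true = inj₂ refl
  ... | false = inj₁ refl

  white-unique : ∀ {c e} → black c ≡ false → black e ≡ false → lab c ≡ lab e → fc c ≡ fc e → c ≡ e
  white-unique {c} {e} bc be leq feq with face-orbit G c e feq
  ... | n , refl with iter-reduce nxt {4} (s≤s z≤n) (face-len4 Q c) n
  ...   | zero , _ , eq = sym eq
  ...   | suc zero , _ , eq with trans (sym be) (trans (cong black eq) (trans (black-nxt c) (cong not bc)))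
  ...     | ()
  white-unique {c} {e} bc be leq feq | n , refl | suc (suc zero) , _ , eq =
    ⊥-elim (opp-≢ (lab c) (trans leq (trans (cong lab eq) lab²)))
    where
      lab² : lab (nxt (nxt c)) ≡ opp (lab c)
      lab² = trans (flow (nxt c)) (cong₂ oppIf (trans (black-nxt c) (cong not bc))
               (trans (flow c) (cong (λ x → oppIf x (lab c)) bc)))
  white-unique {c} {e} bc be leq feq | n , refl | suc (suc (suc zero)) , _ , eq
    with trans (sym be) (trans (cong black eq) (trans (black-nxt _) (cong not (trans (black-nxt _) (cong not (trans (black-nxt c) (cong not bc)))))))
  ...     | ()
  white-unique {c} {e} bc be leq feq | n , refl | suc (suc (suc (suc _))) , s≤s (s≤s (s≤s (s≤s ()))) , eq

  -- Equal white ends leave two darts of one edge, and by (G2) an edge is not a turn from both ends.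
  Hit-vertex : ∀ {i v w f} → Hit i v f → Hit i w f → v ≡ w
  Hit-vertex (d , refl , t , refl) (e , refl , u , eq) =
    decide (white-end-either d) (white-end-either e)
      (white-unique (white-end-white d) (white-end-white e)
        (trans (white-end-lab d t) (sym (white-end-lab e u)))
        (trans (white-end-face d) (trans (sym eq) (sym (white-end-face e)))))
    where
      decide : ∀ {x y} → x ≡ d ⊎ x ≡ rev d → y ≡ e ⊎ y ≡ rev e → x ≡ y → src d ≡ src e
      decide (inj₁ refl) (inj₁ refl) refl = refl
      decide (inj₁ refl) (inj₂ refl) refl = ⊥-elim (Turn-rev u t)
      decide (inj₂ refl) (inj₁ refl) refl = ⊥-elim (Turn-rev t u)
      decide (inj₂ p) (inj₂ q) r = cong src (rev-injective (trans (sym p) (trans r q)))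

  -- Walks along the equator.

  data Walk (i : Fin 2) : Face → List Vtx → Face → Set where
    stop : ∀ {f} → Walk i f [] f
    pass : ∀ {f v g vs h} → Hit (opp i) v f → Hit i v g → Walk i g vs h → Walk i f (v ∷ vs) h

  walk-++ : ∀ {i f vs g ws h} → Walk i f vs g → Walk i g ws h → Walk i f (vs ++ ws) h
  walk-++ stop w = w
  walk-++ (pass a b u) w = pass a b (walk-++ u w)

  walk-split : ∀ {i f} vs {ws h} → Walk i f (vs ++ ws) h → ∃ λ g → Walk i f vs g × Walk i g ws h
  walk-split [] w = _ , stop , w
  walk-split (v ∷ vs) (pass a b w) with walk-split vs w
  ... | g , u , u′ = g , (pass a b u) , u′

  walk-reverse : ∀ {i f vs g} → Walk i f vs g → Walk (opp i) g (reverse vs) f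
  walk-reverse stop = stop
  walk-reverse {i} (pass {f = f} {v = v} {vs = vs} a b w) =
    subst (λ l → Walk (opp i) _ l _) (sym (unfold-reverse v vs))
      (walk-++ (walk-reverse w) (pass (subst (λ j → Hit j v _) (sym (opp-involutive i)) b) a stop))

  walk-last : ∀ {i f vs g} → Walk i f vs g → (vs ≡ [] × f ≡ g) ⊎ ∃ λ v → v ∈ vs × Hit i v g
  walk-last stop = inj₁ (refl , refl)
  walk-last (pass {v = v} a b w) with walk-last w
  ... | inj₁ (refl , refl) = inj₂ (v , here refl , b)
  ... | inj₂ (u , u∈ , h) = inj₂ (u , there u∈ , h)

  walk-inner : ∀ {i f vs g v} → Walk i f vs g → v ∈ vs → ∀ j → v ≢ root j
  walk-inner (pass a b w) (here refl) = Hit-inner b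
  walk-inner (pass a b w) (there v∈) = walk-inner w v∈

  walk-compare : ∀ {i f xs g ys h} → Walk i f xs g → Walk i f ys h →
    (∃ λ zs → ys ≡ xs ++ zs × Walk i g zs h) ⊎ (∃ λ zs → xs ≡ ys ++ zs × Walk i h zs g)
  walk-compare stop w = inj₁ (_ , refl , w)
  walk-compare u@(pass _ _ _) stop = inj₂ (_ , refl , u)
  walk-compare (pass a b u) (pass a′ b′ w) with Hit-vertex a a′
  ... | refl with Hit-face b b′
  ... | refl with walk-compare u w
  ... | inj₁ (zs , refl , v) = inj₁ (zs , refl , v)
  ... | inj₂ (zs , refl , v) = inj₂ (zs , refl , v)

  closed-suffix-empty : ∀ {i f xs zs} → Walk i f xs f → Walk i f zs f → xs ≢ [] → Unique (xs ++ zs) → zs ≡ []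
  closed-suffix-empty stop _ nx _ = ⊥-elim (nx refl)
  closed-suffix-empty (pass _ _ _) stop _ _ = refl
  closed-suffix-empty (pass a _ _) (pass b _ _) _ uniq with Hit-vertex a b
  ... | refl = ⊥-elim (unique-disjoint uniq (here refl) (here refl))

  -- Every step is forced, so one walk is a prefix of the other; a non-empty rest would again be
  -- closed and would repeat the first vertex.
  closed-walk-unique : ∀ {i f xs ys} → Walk i f xs f → Walk i f ys f → Unique xs → Unique ys →
    xs ≢ [] → ys ≢ [] → xs ≡ ys
  closed-walk-unique {xs = xs} {ys} u w ux uy nx ny with walk-compare u w
  ... | inj₁ (zs , refl , v) = sym (trans (cong (xs ++_) (closed-suffix-empty u v nx uy)) (++-identityʳ xs))
  ... | inj₂ (zs , refl , v) = trans (cong (ys ++_) (closed-suffix-empty w v ny ux)) (++-identityʳ ys)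

  -- Contours of subtrees

  data Below (i : Fin 2) (u : Vtx) : Vtx → Set where
    here : Below i u u
    up : ∀ {d} → T i d → Below i u (tgt d) → Below i u (src d)

  below-trans : ∀ {i u v w} → Below i u v → Below i v w → Below i u w
  below-trans b here = b
  below-trans b (up t c) = up t (below-trans b c)

  below-child : ∀ {i u w} → Below i u w → w ≡ u ⊎ ∃ λ c → T i c × tgt c ≡ u × Below i (src c) w
  below-child here = inj₁ refl
  below-child (up {d} t b) with below-child b
  ... | inj₁ eq = inj₂ (d , t , eq , here)
  ... | inj₂ (c , tc , eq , b′) = inj₂ (c , tc , eq , up t b′)

  below-parent : ∀ {i u d} → T i d → Below i u (src d) → src d ≡ u ⊎ Below i u (tgt d)
  below-parent {i} {u} {d} t b = go b refl
    where
      go : ∀ {w} → Below i u w → w ≡ src d → src d ≡ u ⊎ Below i u (tgt d)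
      go here eq = inj₁ (sym eq)
      go (up {e} te b) eq with T-unique eq te t
      ... | refl = inj₂ b

  -- A certificate that the way up from a vertex ends at the root. As long as `T i` might contain
  -- cycles elsewhere, acyclicity can be used only where a depth is known.
  data Depth (i : Fin 2) : ℕ → Vtx → Set where
    root-depth : Depth i 0 (root i)
    child-depth : ∀ {n d} → T i d → Depth i n (tgt d) → Depth i (suc n) (src d)

  depth-parent : ∀ {i n d} → T i d → Depth i n (src d) → ∃ λ m → n ≡ suc m × Depth i m (tgt d)
  depth-parent {i} {n} {d} t r = go r refl
    where
      go : ∀ {n w} → Depth i n w → w ≡ src d → ∃ λ m → n ≡ suc m × Depth i m (tgt d)
      go root-depth eq = ⊥-elim (T-inner t i (sym eq))
      go (child-depth {e} {f} te r) eq with T-unique eq te t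
      ... | refl = _ , refl , r

  depth-unique : ∀ {i m n v} → Depth i m v → Depth i n v → m ≡ n
  depth-unique {i} root-depth r = go r refl
    where
      go : ∀ {n w} → Depth i n w → w ≡ root i → 0 ≡ n
      go root-depth _ = refl
      go (child-depth t _) eq = ⊥-elim (T-inner t i eq)
  depth-unique (child-depth t q) r with depth-parent t r
  ... | _ , refl , r′ = cong suc (depth-unique q r′)

  depth-below : ∀ {i m u w} → Depth i m u → Below i u w → ∃ λ k → Depth i (k + m) w
  depth-below r here = 0 , r
  depth-below r (up t b) with depth-below r b
  ... | k , r′ = suc k , child-depth t r′

  below-root⇒depth : ∀ {i w} → Below i (root i) w → ∃ λ n → Depth i n w
  below-root⇒depth b with depth-below root-depth b
  ... | k , r = _ , r

  below-antisym : ∀ {i n u v} → Depth i n u → Below i u v → Below i v u → u ≡ v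
  below-antisym r here c = refl
  below-antisym {n = n} r (up t b′) c with depth-below r b′
  ... | k , r′ with depth-below (child-depth t r′) c
  ...   | l , r‴ = ⊥-elim (m≢1+n+m n (trans (depth-unique r r‴) (trans (+-suc l (k + n)) (cong suc (sym (+-assoc l k n))))))

  -- Parents are unique, so the ways up from `w` to `a` and to `b` coincide until the depth `n`.
  -- This makes the subtrees of siblings disjoint.
  below-same-depth : ∀ {i n a b w} → Depth i n a → Depth i n b → Below i a w → Below i b w → a ≡ b
  below-same-depth {n = n} ra rb here b with depth-below rb b
  ... | zero , _ with b
  ...   | here = refl
  ...   | up t b′ with depth-below rb b′
  ...     | k , r = ⊥-elim (m≢1+n+m n (depth-unique ra (child-depth t r)))
  below-same-depth {n = n} ra rb here b | suc k , r = ⊥-elim (m≢1+n+m n (depth-unique ra r))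
  below-same-depth {n = n} ra rb (up t a) b with below-parent t b
  ... | inj₂ b′ = below-same-depth ra rb a b′
  ... | inj₁ refl with depth-below ra a
  ...   | k , r = ⊥-elim (m≢1+n+m n (depth-unique rb (child-depth t r)))

  depth-ancestor : ∀ {i n v} → Depth i n v → ∀ j → j ≤ n → ∃ λ u → Depth i j u
  depth-ancestor r j le with m≤n⇒m<n∨m≡n le
  ... | inj₂ refl = _ , r
  depth-ancestor (child-depth _ r) j le | inj₁ (s≤s le′) = depth-ancestor r j le′

  -- Ancestors of different depths are different vertices, so the pigeonhole principle applies to
  -- the depths from 0 to `n`.
  depth-bound : ∀ {i n v} → Depth i n v → n < nV G
  depth-bound {i} {n} r with n <? nV G
  ... | yes lt = lt
  ... | no ≮ with pigeonhole (s≤s (≮⇒≥ ≮)) (λ j → proj₁ (depth-ancestor r (toℕ j) (s≤s⁻¹ (toℕ<n j))))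
  ...   | a , b , a<b , eq = ⊥-elim (<-irrefl (depth-unique
          (proj₂ (depth-ancestor r (toℕ a) (s≤s⁻¹ (toℕ<n a))))
          (subst (Depth i _) (sym eq) (proj₂ (depth-ancestor r (toℕ b) (s≤s⁻¹ (toℕ<n b)))))) a<b)

  -- In the order of Walk i, a black vertex comes after its descendants in T i, a white one before them.
  Extreme : Bool → Vtx → List Vtx → Set
  Extreme true v vs = ∃ λ us → vs ≡ us ∷ʳ v
  Extreme false v vs = ∃ λ us → vs ≡ v ∷ us

  record Contour (i : Fin 2) (d : Dart) (vs : List Vtx) : Set where
    field
      trace : Walk i (fc d) vs (fc (rev d))
      sound : ∀ {w} → w ∈ vs → Below i (src d) w
      total : ∀ {w} → Below i (src d) w → w ∈ vs
      extreme : Extreme (black d) (src d) vs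

  -- Remembers the contour of each subtree as a segment of the larger walk, so that all intervals of
  -- descendants can later be read off from the root alone.
  record Nested (i : Fin 2) (vs : List Vtx) (w : Vtx) : Set where
    field
      dart : Dart
      in-T : T i dart
      src-dart : src dart ≡ w
      pre inside post : List Vtx
      split : vs ≡ pre ++ inside ++ post
      contour : Contour i dart inside

  nested-++ˡ : ∀ {i us w} vs → Nested i us w → Nested i (us ++ vs) w
  nested-++ˡ vs n = record { Nested n ; post = post ++ vs ; split = trans (cong (_++ vs) split)
      (trans (++-assoc pre (inside ++ post) vs) (cong (pre ++_) (++-assoc inside post vs))) }
    where open Nested n

  nested-++ʳ : ∀ {i vs w} us → Nested i vs w → Nested i (us ++ vs) w
  nested-++ʳ us n = record { Nested n ; pre = us ++ pre ; split = trans (cong (us ++_) split) (sym (++-assoc us pre _)) }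
    where open Nested n

  Developed : Fin 2 → List Vtx → Set
  Developed i vs = Unique vs × (∀ {w} → w ∈ vs → Nested i vs w)

  developed-++ : ∀ {i us vs} → Developed i us → Developed i vs → (∀ {w} → w ∈ us → w ∉ vs) → Developed i (us ++ vs)
  developed-++ {us = us} {vs} (uu , nu) (uv , nv) dis =
    Unique.++⁺ uu uv (λ (p , q) → dis p q) , nest
    where
      nest : ∀ {w} → w ∈ us ++ vs → Nested _ (us ++ vs) w
      nest w∈ with ∈-++⁻ us w∈
      ... | inj₁ p = nested-++ˡ vs (nu p)
      ... | inj₂ p = nested-++ʳ us (nv p)

  record Sweep (i : Fin 2) (e : Dart) (t : ℕ) : Set where
    field
      verts : List Vtx
      trace : Walk i (fc e) verts (fc ((rot ^[ t ]) e))
      sound : ∀ {w} → w ∈ verts → ∃ λ j → j < t × Below i (tgt ((rot ^[ suc j ]) e)) w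
      total : ∀ {w} j → j < t → Below i (tgt ((rot ^[ suc j ]) e)) w → w ∈ verts
      developed : Developed i verts

  sector-child : ∀ {i} e t → lab ((rot ^[ t ]) e) ≡ i → lab ((rot ^[ suc t ]) e) ≡ i → T i (rev ((rot ^[ suc t ]) e))
  sector-child e t p q = trans (cong lab (α-invol G _)) q ,
    trans (cong (λ x → lab (rot⁻ x)) (α-invol G _)) (trans (cong lab (σ⁻σ G _)) p)

  -- The darts strictly inside a sector of i-labelled angles are the reversals of the T i-darts entering
  -- its apex, so the contours of the children concatenate to a walk across the sector.
  module _ {i : Fin 2} (e : Dart) {n : ℕ} (depth : Depth i n (src e))
           (contours : ∀ c → T i c → tgt c ≡ src e → ∃ λ vs → Contour i c vs × Developed i vs) where

    tgt-sector-child : ∀ t → tgt (rev ((rot ^[ suc t ]) e)) ≡ src e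
    tgt-sector-child t = trans (cong src (α-invol G _)) (src-iter (suc t) e)

    opaque
      -- `fresh` says nothing about the last dart `(rot ^[ t ]) e`, which may be `e` again: around a
      -- root the sector is a full turn.
      sweep : ∀ t → (∀ j → j ≤ t → lab ((rot ^[ j ]) e) ≡ i) → (∀ j → suc j < t → (rot ^[ suc j ]) e ≢ e) → Sweep i e t
      sweep zero _ _ = record { verts = [] ; trace = stop ; sound = λ () ; total = λ _ () ; developed = [] , λ () }
      sweep (suc t) labels fresh with sweep t (λ j le → labels j (≤-trans le (n≤1+n t))) (λ j lt → fresh j (m<n⇒m<1+n lt))
                                    | contours (rev ((rot ^[ suc t ]) e)) child (tgt-sector-child t)
        where
          child : T i (rev ((rot ^[ suc t ]) e))
          child = sector-child e t (labels t (n≤1+n t)) (labels (suc t) ≤-refl)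
      ... | S | cs , C , D = record
        { verts = verts ++ cs
        ; trace = walk-++ trace (subst₂ (λ f g → Walk i f cs g) (face-φ G _) (cong fc (α-invol G _)) (Contour.trace C))
        ; sound = snd
        ; total = tot
        ; developed = developed-++ developed D disjoint
        }
        where
          open Sweep S

          snd : ∀ {w} → w ∈ verts ++ cs → ∃ λ j → j < suc t × Below i (tgt ((rot ^[ suc j ]) e)) w
          snd w∈ with ∈-++⁻ verts w∈
          ... | inj₂ p = t , n<1+n t , Contour.sound C p
          ... | inj₁ p with sound p
          ...   | j , lt , b = j , m<n⇒m<1+n lt , b

          tot : ∀ {w} j → j < suc t → Below i (tgt ((rot ^[ suc j ]) e)) w → w ∈ verts ++ cs
          tot j (s≤s le) b with m≤n⇒m<n∨m≡n le
          ... | inj₁ lt = ∈-++⁺ˡ (total j lt b)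
          ... | inj₂ refl = ∈-++⁺ʳ verts (Contour.total C b)

          distinct : ∀ j → j < t → (rot ^[ suc j ]) e ≢ (rot ^[ suc t ]) e
          distinct j lt eq with m<n⇒∃k lt
            where
              m<n⇒∃k : ∀ {m n} → m < n → ∃ λ k → n ≡ m + suc k
              m<n⇒∃k {m} (s≤s {n = n} le) = n ∸ m , trans (cong suc (sym (m+[n∸m]≡n le))) (sym (+-suc m _))
          ... | k , refl = fresh k (s≤s (subst (suc k ≤_) refl (m≤n+m (suc k) j)))
                (sym (iter-injective rot rot-injective (suc j) (trans eq (iter-+ rot (suc j) (suc k) e))))

          disjoint : ∀ {w} → w ∈ verts → w ∉ cs
          disjoint p q with sound p
          ... | j , lt , b = distinct j lt (rev-injective (T-unique
                  (below-same-depth (child-depth tj (subst (Depth i n) (sym (tgt-sector-child j)) depth))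
                                    (child-depth tt (subst (Depth i n) (sym (tgt-sector-child t)) depth))
                                    b (Contour.sound C q)) tj tt))
            where
              tj : T i (rev ((rot ^[ suc j ]) e))
              tj = sector-child e j (labels j (<⇒≤ (m<n⇒m<1+n lt))) (labels (suc j) (s≤s (<⇒≤ lt)))
              tt : T i (rev ((rot ^[ suc t ]) e))
              tt = sector-child e t (labels t (n≤1+n t)) (labels (suc t) ≤-refl)

    children-swept : ∀ t (S : Sweep i e t) →
      (∀ c → T i c → tgt c ≡ src e → ∃ λ j → j < t × (rot ^[ suc j ]) e ≡ rev c) →
      ∀ {w} → Below i (src e) w → w ≡ src e ⊎ w ∈ Sweep.verts S
    children-swept t S all b with below-child b
    ... | inj₁ eq = inj₁ eq
    ... | inj₂ (c , tc , eq , b′) with all c tc eq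
    ...   | j , lt , q = inj₂ (Sweep.total S j lt (subst (λ x → Below i (src x) _) (trans (sym (α-invol G c)) (cong rev (sym q))) b′))

    -- The strictly larger depth keeps the apex out of its own sweep.
    swept-below : ∀ t (S : Sweep i e t) → (∀ j → j ≤ t → lab ((rot ^[ j ]) e) ≡ i) →
      ∀ {w} → w ∈ Sweep.verts S → Below i (src e) w × ∃ λ k → Depth i (suc k + n) w
    swept-below t S labels {w} p with Sweep.sound S p
    ... | j , lt , b = below-trans (up tj (subst (λ v → Below i (src e) v) (sym (tgt-sector-child j)) here)) b , deep
      where
        tj = sector-child e j (labels j (<⇒≤ lt)) (labels (suc j) lt)
        deep : ∃ λ k → Depth i (suc k + n) w
        deep with depth-below (child-depth tj (subst (Depth i n) (sym (tgt-sector-child j)) depth)) b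
        ... | k , r = k , subst (λ m → Depth i m w) (+-suc k n) r

  module _ {i n d} (t : T i d) (r : Depth i n (src d)) (R : Run i (src d))
           (contours : ∀ c → T i c → tgt c ≡ src (Run.first R) → ∃ λ vs → Contour i c vs × Developed i vs) where
    private
      module R = Run R

      v : Vtx
      v = src d

      -- The sector of `i`-angles at `v` lies between `q` and `p`. The out-dart `d` is `q` if `v` is
      -- black and `p` if it is white.
      q p : Dart
      q = R.first
      p = rot ((rot ^[ R.len ]) q)

      r′ : Depth i n (src q)
      r′ = subst (Depth i n) (sym R.at) r

      S : Sweep i q R.len
      S = sweep q r′ contours R.len R.during (λ j lt → R.no-return j (<⇒≤ lt))
      open Sweep S

      at-sector : ∀ c → T i c → tgt c ≡ src q → ∃ λ j → j < R.len × (rot ^[ suc j ]) q ≡ rev c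
      at-sector c (lc , lc⁻) eq with R.complete (rev c) (trans eq R.at) lc
      -- The dart that opens the run has an `opp i`-angle on its right, whereas the dart towards a
      -- child has label `i` on both sides.
      ... | zero , _ , eq′ = ⊥-elim (opp-≢ i (trans (sym lc⁻) (trans (cong (λ x → lab (rot⁻ x)) (sym eq′)) R.before)))
      ... | suc j , lt , eq′ = j , lt , eq′

      sound′ : ∀ {w} → w ∈ verts → Below i v w
      sound′ p = subst (λ x → Below i x _) R.at (proj₁ (swept-below q r′ contours R.len S R.during p))

      total′ : ∀ {w} → Below i v w → w ≡ v ⊎ w ∈ verts
      total′ b with children-swept q r′ contours R.len S at-sector (subst (λ x → Below i x _) (sym R.at) b)
      ... | inj₁ eq = inj₁ (trans eq R.at)
      ... | inj₂ w∈ = inj₂ w∈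

      v∉ : v ∉ verts
      v∉ v∈ with swept-below q r′ contours R.len S R.during v∈
      ... | _ , k , deep = m≢1+n+m n (depth-unique r deep)

      end-face : fc ((rot ^[ R.len ]) q) ≡ fc (rev p)
      end-face = sym (face-φ G _)

      whole : ∀ vs → Contour i d vs → Unique vs → (∀ {w} → w ∈ vs → w ≡ v ⊎ Nested i vs w) → Developed i vs
      whole vs C u nest = u , λ w∈ → self (nest w∈)
        where
          self : ∀ {w} → w ≡ v ⊎ Nested i vs w → Nested i vs w
          self (inj₂ x) = x
          self (inj₁ refl) = record { dart = d ; in-T = t ; src-dart = refl ; pre = [] ; inside = vs ; post = []
                                    ; split = sym (++-identityʳ vs) ; contour = C }

    -- If `v` is black, the sweep goes from `fc d` to `fc (rev p)`, whence the equator passes `v`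
    -- into `fc (rev d)`. If `v` is white, the equator first passes `v` from `fc d` into `fc q`, and
    -- the sweep then ends in `fc (rev d)`.
    contour-at : ∀ b → black d ≡ b → ∃ λ vs → Contour i d vs × Developed i vs
    contour-at true bd = verts ∷ʳ v , C ,
        whole _ C (Unique.++⁺ (proj₁ developed) ([] ∷ []) (λ { (x , here refl) → v∉ x })) nest
      where
        d≡q : d ≡ q
        d≡q = sym (R.turn-first refl (subst (λ c → Turn (oppIf (not c) i) d) bd (T⇒Turn t)))

        hit-p : Hit (opp i) v (fc ((rot ^[ R.len ]) q))
        hit-p = p , R.src-at (suc R.len) , R.last-turn ,
          trans (side-black (trans (cong (col Q) (R.src-at (suc R.len))) bd)) (sym end-face)

        hit-q : Hit i v (fc (rev d))
        hit-q = q , R.at , R.first-turn , trans (side-black (trans (cong (col Q) R.at) bd)) (cong (λ x → fc (rev x)) (sym d≡q))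

        tot : ∀ {w} → Below i v w → w ∈ verts ∷ʳ v
        tot b with total′ b
        ... | inj₁ refl = ∈-++⁺ʳ verts (here refl)
        ... | inj₂ x = ∈-++⁺ˡ x

        snd : ∀ {w} → w ∈ verts ∷ʳ v → Below i v w
        snd w∈ with ∈-++⁻ verts w∈
        ... | inj₁ x = sound′ x
        ... | inj₂ (here refl) = here

        nest : ∀ {w} → w ∈ verts ∷ʳ v → w ≡ v ⊎ Nested i (verts ∷ʳ v) w
        nest w∈ with ∈-++⁻ verts w∈
        ... | inj₁ x = inj₂ (nested-++ˡ [ v ] (proj₂ developed x))
        ... | inj₂ (here refl) = inj₁ refl

        C : Contour i d (verts ∷ʳ v)
        C = record
          { trace = walk-++ (subst (λ x → Walk i (fc x) verts (fc ((rot ^[ R.len ]) q))) (sym d≡q) trace) (pass hit-p hit-q stop)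
          ; sound = snd ; total = tot
          ; extreme = subst (λ b → Extreme b v (verts ∷ʳ v)) (sym bd) (verts , refl) }
    contour-at false bd = v ∷ verts , C ,
        whole _ C (tabulate (λ x eq → v∉ (subst (_∈ verts) (sym eq) x)) ∷ proj₁ developed) nest
      where
        d≡p : d ≡ p
        d≡p = Turn-unique (sym (R.src-at (suc R.len))) (subst (λ c → Turn (oppIf (not c) i) d) bd (T⇒Turn t)) R.last-turn

        hit-p : Hit (opp i) v (fc d)
        hit-p = p , R.src-at (suc R.len) , R.last-turn ,
          trans (side-white (trans (cong (col Q) (R.src-at (suc R.len))) bd)) (cong fc (sym d≡p))

        hit-q : Hit i v (fc q)
        hit-q = q , R.at , R.first-turn , side-white (trans (cong (col Q) R.at) bd)

        tot : ∀ {w} → Below i v w → w ∈ v ∷ verts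
        tot b with total′ b
        ... | inj₁ refl = here refl
        ... | inj₂ x = there x

        snd : ∀ {w} → w ∈ v ∷ verts → Below i v w
        snd (here refl) = here
        snd (there x) = sound′ x

        nest : ∀ {w} → w ∈ v ∷ verts → w ≡ v ⊎ Nested i (v ∷ verts) w
        nest (here refl) = inj₁ refl
        nest (there x) = inj₂ (nested-++ʳ [ v ] (proj₂ developed x))

        C : Contour i d (v ∷ verts)
        C = record
          { trace = pass hit-p hit-q (subst (Walk i (fc q) verts) (trans end-face (cong (λ x → fc (rev x)) (sym d≡p))) trace)
          ; sound = snd ; total = tot
          ; extreme = subst (λ b → Extreme b v (v ∷ verts)) (sym bd) (verts , refl) }

  -- The recursion goes to children, away from the root, so it is driven by fuel; fuel and depth
  -- together stay at least `nV`, so running out contradicts `depth-bound`.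
  contour-exists : ∀ fuel {i n d} → T i d → Depth i n (src d) → nV G ≤ fuel + n →
    ∃ λ vs → Contour i d vs × Developed i vs
  contour-exists zero t r le = ⊥-elim (≤⇒≯ le (depth-bound r))
  contour-exists (suc fuel) {i} {n} {d} t r le = contour-at t r R
      (λ c tc eq → contour-exists fuel tc
        (child-depth tc (subst (Depth i n) (sym (trans eq (Run.at R))) r)) (subst (nV G ≤_) (sym (+-suc fuel n)) le))
      (black d) refl
    where
      R : Run i (src d)
      R = run-at i (src d) (T-inner t)

  -- The equator

  angle : Fin 2 → Dart
  angle zero = a₀
  angle (suc _) = (nxt ^[ 2 ]) a₀

  src-angle : ∀ i → src (angle i) ≡ root i
  src-angle zero = refl
  src-angle (suc _) = refl

  fc-angle : ∀ i → fc (angle i) ≡ outer Q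
  fc-angle zero = a₀-outer
  fc-angle (suc _) = trans (iter-inv nxt fc (face-φ G) 2 a₀) a₀-outer

  -- The counterpart of a contour for the root, which has no out-dart: a full turn that starts and
  -- ends in the outer face and does not pass the root.
  record Spine (i : Fin 2) : Set where
    field
      verts : List Vtx
      trace : Walk i (outer Q) verts (outer Q)
      sound : ∀ {w} → w ∈ verts → Below i (root i) w
      total : ∀ {w} → Below i (root i) w → w ≡ root i ⊎ w ∈ verts
      developed : Developed i verts
      nonempty : verts ≢ []

  opaque
    spine : ∀ i → Spine i
    spine i with vert-orbit G (rot (angle i)) (angle i) (vert-σ G (angle i))
    ... | n , back with least (λ k → (rot ^[ suc k ]) (angle i) ≟ angle i) n (trans (iter-suc rot n (angle i)) back)
    ... | m , period , minimal = record
      { verts = verts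
      ; trace = subst₂ (λ f g → Walk i f verts g) (fc-angle i) (trans (cong fc period) (fc-angle i)) trace
      ; sound = λ w∈ → subst (λ v → Below i v _) (src-angle i) (proj₁ (swept-below e depth contours (suc m) S (λ j _ → labels j) w∈))
      ; total = total′
      ; developed = developed
      ; nonempty = λ eq → nowhere (subst (tgt (rot e) ∈_) eq (total 0 (s≤s z≤n) here))
      }
      where
        e : Dart
        e = angle i

        nowhere : ∀ {v : Vtx} → v ∉ []
        nowhere ()

        depth : Depth i 0 (src e)
        depth = subst (Depth i 0) (sym (src-angle i)) root-depth

        labels : ∀ j → lab ((rot ^[ j ]) e) ≡ i
        labels j = lab-root i (trans (src-iter j e) (src-angle i))

        contours : ∀ c → T i c → tgt c ≡ src e → ∃ λ vs → Contour i c vs × Developed i vs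
        contours c tc eq = contour-exists (nV G) tc (child-depth tc (subst (Depth i 0) (sym eq) depth)) (m≤m+n (nV G) 1)

        S : Sweep i e (suc m)
        S = sweep e depth contours (suc m) (λ j _ → labels j) (λ { j (s≤s lt) → minimal j lt })

        open Sweep S

        at-root : ∀ c → T i c → tgt c ≡ src e → ∃ λ j → j < suc m × (rot ^[ suc j ]) e ≡ rev c
        at-root c tc eq with vert-orbit G e (rev c) (sym eq)
        ... | k , turn with iter-reduce rot {suc m} (s≤s z≤n) period k
        -- A sweep counts darts after `e`, so `e` itself is met only at the end of the turn.
        ...   | zero , _ , q = m , n<1+n m , trans period (trans (sym q) turn)
        ...   | suc j , s≤s lt , q = j , ≤-trans lt (n≤1+n m) , trans (sym q) turn

        total′ : ∀ {w} → Below i (root i) w → w ≡ root i ⊎ w ∈ verts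
        total′ b with children-swept e depth contours (suc m) S at-root (subst (λ v → Below i v _) (sym (src-angle i)) b)
        ... | inj₁ eq = inj₁ (trans eq (src-angle i))
        ... | inj₂ w∈ = inj₂ w∈

  equator : List Vtx
  equator = Spine.verts (spine 0F)

  equator-walk : Walk 0F (outer Q) equator (outer Q)
  equator-walk = Spine.trace (spine 0F)

  equator-unique : Unique equator
  equator-unique = proj₁ (Spine.developed (spine 0F))

  equator-reversed : Spine.verts (spine 1F) ≡ reverse equator
  equator-reversed = closed-walk-unique (Spine.trace (spine 1F)) (walk-reverse equator-walk)
    (proj₁ (Spine.developed (spine 1F))) (Unique-resp-↭ (setoid _) (↭⇒↭ₛ (↭-sym (↭-reverse equator))) equator-unique)
    (Spine.nonempty (spine 1F)) (λ eq → Spine.nonempty (spine 0F) (trans (sym (reverse-involutive equator)) (cong reverse eq)))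

  equator⇒below : ∀ i {w} → w ∈ equator → Below i (root i) w
  equator⇒below zero = Spine.sound (spine 0F)
  equator⇒below (suc zero) w∈ = Spine.sound (spine 1F) (subst (_ ∈_) (sym equator-reversed) (Any.reverse⁺ w∈))

  below⇒equator : ∀ i {w} → Below i (root i) w → w ≡ root i ⊎ w ∈ equator
  below⇒equator zero = Spine.total (spine 0F)
  below⇒equator (suc zero) b with Spine.total (spine 1F) b
  ... | inj₁ eq = inj₁ eq
  ... | inj₂ w∈ = inj₂ (Any.reverse⁻ (subst (_ ∈_) equator-reversed w∈))

  coloured : ∀ d → ∃ λ i → T i d ⊎ T i (rev d)
  coloured d with lab d ≟ lab (rot⁻ d)
  ... | no ne = _ , inj₁ (Turn⇒T (refl , ≢⇒≡opp (λ eq → ne (sym eq))))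
  ... | yes eq = _ , inj₂ (Turn⇒T (refl , ≢⇒≡opp (λ eq′ → Equivalence.to (G2 d) eq (sym eq′))))

  -- This is closed under adjacency: an equator vertex lies below both roots, so along an edge of
  -- either colour its neighbour lies below a root again.
  Placed : Vtx → Set
  Placed v = (∃ λ i → v ≡ root i) ⊎ v ∈ equator

  placed-below : ∀ i {v} → Below i (root i) v → Placed v
  placed-below i b with below⇒equator i b
  ... | inj₁ eq = inj₁ (i , eq)
  ... | inj₂ v∈ = inj₂ v∈

  placed-tgt : ∀ {i d} → T i d → Placed (src d) → Placed (tgt d)
  placed-tgt t (inj₁ (j , eq)) = ⊥-elim (T-inner t j eq)
  placed-tgt {i} t (inj₂ v∈) with below-parent t (equator⇒below i v∈)
  ... | inj₁ eq = ⊥-elim (T-inner t i eq)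
  ... | inj₂ b = placed-below i b

  T-tgt-root : ∀ {i j d} → T i d → tgt d ≡ root j → i ≡ j
  T-tgt-root {j = j} (p , _) eq = trans (sym p) (lab-root j eq)

  placed-src : ∀ {i d} → T i d → Placed (tgt d) → Placed (src d)
  placed-src {i} {d} t (inj₁ (j , eq)) with T-tgt-root {i} {j} {d} t eq
  ... | refl = placed-below i (up t (subst (Below i (root i)) (sym eq) here))
  placed-src {i} t (inj₂ v∈) = placed-below i (up t (equator⇒below i v∈))

  placed-rev : ∀ {d} → Placed (src d) → Placed (tgt d)
  placed-rev {d} pl with coloured d
  ... | i , inj₁ t = placed-tgt t pl
  ... | i , inj₂ t = placed-src t (subst (λ e → Placed (src e)) (sym (α-invol G d)) pl)

  opaque
    placed : ∀ v → Placed v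
    placed v with vert-surj G v
    ... | e , refl with connected G a₀ e
    ...   | w , refl = go w (inj₁ (0F , refl))
      where
        go : ∀ w {d} → Placed (src d) → Placed (src (run rot rev w d))
        go [] pl = pl
        go (true ∷ w) {d} pl = go w (subst Placed (sym (vert-σ G d)) pl)
        go (false ∷ w) pl = go w (placed-rev pl)

  inner∈equator : ∀ {v} → (∀ j → v ≢ root j) → v ∈ equator
  inner∈equator {v} inner with placed v
  ... | inj₁ (j , eq) = ⊥-elim (inner j eq)
  ... | inj₂ v∈ = v∈

  below-root : ∀ i {v} → v ≢ root (opp i) → Below i (root i) v
  below-root i {v} ne with placed v
  ... | inj₂ v∈ = equator⇒below i v∈
  ... | inj₁ (j , eq) with j ≟ i
  ...   | yes refl = subst (Below i (root i)) (sym eq) here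
  ...   | no j≢i = ⊥-elim (ne (trans eq (cong root (≢⇒≡opp j≢i))))

  -- Walk 1F runs along the equator backwards, which exchanges the two sides of a T 1F-dart and
  -- the two ends of its contour.
  near far : Fin 2 → Dart → Face
  near zero d = fc d
  near (suc _) d = fc (rev d)
  far zero d = fc (rev d)
  far (suc _) d = fc d

  endmost : Fin 2 → Bool → Bool
  endmost zero b = b
  endmost (suc _) b = not b

  extreme-reverse : ∀ b {v vs} → Extreme b v vs → Extreme (not b) v (reverse vs)
  extreme-reverse true (us , refl) = reverse us , reverse-++ us [ _ ]
  extreme-reverse false (us , refl) = reverse us , unfold-reverse _ us

  record Block (i : Fin 2) (d : Dart) : Set where
    field
      pre inside post : List Vtx
      split : equator ≡ pre ++ inside ++ post
      trace : Walk 0F (near i d) inside (far i d)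
      sound : ∀ {w} → w ∈ inside → Below i (src d) w
      total : ∀ {w} → Below i (src d) w → w ∈ inside
      extreme : Extreme (endmost i (black d)) (src d) inside

  opaque
    block : ∀ i {d} → T i d → Block i d
    block zero t with proj₂ (Spine.developed (spine 0F)) (inner∈equator (T-inner t))
    ... | n with T-unique (Nested.src-dart n) (Nested.in-T n) t
    ...   | refl = record { Nested n ; Contour (Nested.contour n) }
    block (suc zero) {d} t with proj₂ (Spine.developed (spine 1F))
        (subst (src d ∈_) (sym equator-reversed) (Any.reverse⁺ (inner∈equator (T-inner t))))
    ... | n with T-unique (Nested.src-dart n) (Nested.in-T n) t
    ...   | refl = record
      { pre = reverse post ; inside = reverse inside ; post = reverse pre
      ; split = trans (sym (reverse-involutive equator)) (trans (cong reverse (sym equator-reversed))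
          (trans (cong reverse split) (trans (reverse-++ pre (inside ++ post))
            (trans (cong (_++ reverse pre) (reverse-++ inside post)) (++-assoc (reverse post) (reverse inside) (reverse pre))))))
      ; trace = walk-reverse trace
      ; sound = λ w∈ → sound (Any.reverse⁻ w∈)
      ; total = λ b → Any.reverse⁺ (total b)
      ; extreme = extreme-reverse (black d) extreme }
      where
        open Nested n
        open Contour contour

  -- Regions

  walk-start : ∀ {i f f′ vs g g′} → Walk i f vs g → Walk i f′ vs g′ → vs ≢ [] → f ≡ f′
  walk-start stop stop ne = ⊥-elim (ne refl)
  walk-start (pass a _ _) (pass b _ _) _ = Hit-face a b

  walk-end : ∀ {i f vs g g′} → Walk i f vs g → Walk i f vs g′ → g ≡ g′
  walk-end stop stop = refl
  walk-end (pass _ b u) (pass _ b′ w) with Hit-face b b′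
  ... | refl = walk-end u w

  walk-last-∷ : ∀ {i f v vs g} → Walk i f (v ∷ vs) g → ∃ λ u → u ∈ v ∷ vs × Hit i u g
  walk-last-∷ w with walk-last w
  ... | inj₂ last = last

  -- The starting face is left out, which gives one face per vertex and drops the outer face when
  -- the walk starts there.
  walk-faces : ∀ {i f vs g} → Walk i f vs g → List Face
  walk-faces stop = []
  walk-faces (pass {g = g} _ _ w) = g ∷ walk-faces w

  walk-faces-length : ∀ {i f vs g} (w : Walk i f vs g) → length (walk-faces w) ≡ length vs
  walk-faces-length stop = refl
  walk-faces-length (pass _ _ w) = cong suc (walk-faces-length w)

  walk-faces-sound : ∀ {i f vs g h} (w : Walk i f vs g) → h ∈ walk-faces w → ∃ λ u → u ∈ vs × Hit i u h
  walk-faces-sound (pass _ b w) (here refl) = _ , here refl , b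
  walk-faces-sound (pass _ b w) (there h∈) with walk-faces-sound w h∈
  ... | u , u∈ , hit = u , there u∈ , hit

  walk-faces-total : ∀ {i f vs g h u} (w : Walk i f vs g) → u ∈ vs → Hit i u h → h ∈ walk-faces w
  walk-faces-total (pass _ b w) (here refl) hit = here (Hit-face hit b)
  walk-faces-total (pass _ b w) (there u∈) hit = there (walk-faces-total w u∈ hit)

  walk-faces-unique : ∀ {i f vs g} (w : Walk i f vs g) → Unique vs → Unique (walk-faces w)
  walk-faces-unique stop _ = []
  walk-faces-unique {i} (pass {v = v} {vs = vs} _ b w) (fresh ∷ u) = tabulate avoid ∷ walk-faces-unique w u
    where
      avoid : ∀ {h} → h ∈ walk-faces w → _ ≢ h
      avoid h∈ refl with walk-faces-sound w h∈
      ... | x , x∈ , hit with Hit-vertex b hit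
      ...   | refl = lookup fresh x∈ refl

  path-exists : ∀ {i v} → Below i (root i) v → ∃ λ p → PathT Q L i v p
  path-exists here = [] , done
  path-exists (up t b) with path-exists b
  ... | p , path = _ , step t path

  path-sound : ∀ {i v p d} → PathT Q L i v p → d ∈ p → T i d × Below i (src d) v
  path-sound (step t path) (here refl) = t , here
  path-sound (step t path) (there d∈) with path-sound path d∈
  ... | t′ , b = t′ , up t b

  -- A vertex has only one out-dart of each colour, so the path runs through every ancestor of `v`.
  -- Lying on a path thus becomes a question about `Below`.
  path-total : ∀ {i v p d} → PathT Q L i v p → T i d → Below i (src d) v → d ∈ p
  path-total {i} done t b = ⊥-elim (at-root b refl)
    where
      at-root : ∀ {w} → Below i _ w → w ≡ root i → ⊥
      at-root here eq = T-inner t i eq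
      at-root (up t′ _) eq = T-inner t′ i eq
  path-total (step t′ path) t b with below-parent t′ b
  ... | inj₁ eq = here (T-unique (sym eq) t t′)
  ... | inj₂ b′ = there (path-total path t b′)

  T-colour : ∀ {i j d} → T i d → T j d → i ≡ j
  T-colour (p , _) (q , _) = trans (sym p) q

  T-one-way : ∀ {i j d} → T i d → ¬ T j (rev d)
  T-one-way {i} {j} {d} t t′ = Turn-rev (T⇒Turn t) (T⇒Turn {j} {rev d} t′)

  corner : Fin 2 → Dart
  corner i = nxt (angle i)

  rev-corner : ∀ i → rev (corner i) ≡ rot (angle i)
  rev-corner i = α-invol G _

  T-corner : ∀ i → T i (corner i)
  T-corner i = lab-root i (trans (cong src (rev-corner i)) (trans (vert-σ G _) (src-angle i))) ,
    lab-root i (trans (src-rot⁻ _) (trans (cong src (rev-corner i)) (trans (vert-σ G _) (src-angle i))))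

  white-corner : ∀ i → black (corner i) ≡ false
  white-corner i = trans (black-nxt (angle i)) (cong not (trans (cong (col Q) (src-angle i)) (black-root i)))

  corner-hit : ∀ i → Hit (opp i) (src (corner i)) (outer Q)
  corner-hit i = corner i , refl ,
    subst (λ c → Turn (oppIf (not c) i) (corner i)) (white-corner i) (T⇒Turn {i} {corner i} (T-corner i)) ,
    trans (side-white (white-corner i)) (trans (face-φ G (angle i)) (fc-angle i))

  -- Of the four angles of the outer face, two are at the roots and two at the white vertices that
  -- the equator meets from the outer face (`corner-hit`). A vertex with bounded faces on both sides
  -- along the equator is none of these.
  angle-not-outer : ∀ {e g g′} → Hit 1F (src e) g → g ≢ outer Q → Hit 0F (src e) g′ → g′ ≢ outer Q → fc e ≢ outer Q
  angle-not-outer {e} h ne h′ ne′ eq with face-orbit G a₀ e (trans a₀-outer (sym eq))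
  ... | n , refl with iter-reduce nxt {4} (s≤s z≤n) (face-len4 Q a₀) n
  ...   | 0 , _ , q = Hit-inner h 0F (cong src q)
  ...   | 1 , _ , q = ne (Hit-face h (subst (λ x → Hit 1F (src x) (outer Q)) (sym q) (corner-hit 0F)))
  ...   | 2 , _ , q = Hit-inner h 1F (cong src q)
  ...   | 3 , _ , q = ne′ (Hit-face h′ (subst (λ x → Hit 0F (src x) (outer Q)) (sym q) (corner-hit 1F)))
  ...   | suc (suc (suc (suc _))) , s≤s (s≤s (s≤s (s≤s ()))) , _

  module Region {v : Vtx} {as bs : List Vtx} (split-v : equator ≡ as ++ v ∷ bs)
                {p₀ p₁ : List Dart} (path₀ : PathT Q L 0F v p₀) (path₁ : PathT Q L 1F v p₁) where

    path : Fin 2 → List Dart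
    path zero = p₀
    path (suc _) = p₁

    is-path : ∀ i → PathT Q L i v (path i)
    is-path zero = path₀
    is-path (suc zero) = path₁

    Reached : Dart → Set
    Reached = InR₁ Q L p₀ p₁

    -- The claim is that R₁(v) consists of the faces which the equator enters from a vertex before v.
    Passed : Face → Set
    Passed f = ∃ λ u → u ∈ as × Hit 0F u f

    uniq : Unique (as ++ v ∷ bs)
    uniq = subst Unique split-v equator-unique

    -- If `g` is the face in which the equator arrives after `xs`, then `Passed g` only depends on
    -- whether `v` is still to come; `not-passed-after` is the other case.
    passed-before : ∀ {xs ys g} → equator ≡ xs ++ ys → Walk 0F (outer Q) xs g → v ∈ ys → g ≢ outer Q → Passed g
    passed-before {xs} eq w v∈ ne with walk-last w
    ... | inj₁ (_ , eq′) = ⊥-elim (ne (sym eq′))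
    ... | inj₂ (u , u∈ , hit) with prefix-before xs (trans (sym eq) split-v)
                                     (λ v∈xs → unique-disjoint (subst Unique eq equator-unique) v∈xs v∈)
    ...   | cs , refl , _ = u , ∈-++⁺ˡ u∈ , hit

    not-passed-after : ∀ {xs ys g} → equator ≡ xs ++ ys → Walk 0F (outer Q) xs g → v ∈ xs → ¬ Passed g
    not-passed-after {xs} {ys} eq w v∈ (u , u∈ , hit)
      with prefix-after {xs = xs} {ys} (subst Unique eq equator-unique) (trans (sym eq) split-v) v∈
    ... | cs , refl with walk-split as w
    ...   | h , _ , w′ with walk-last-∷ w′
    ...     | x , x∈ , hit′ with Hit-vertex hit hit′
    ...       | refl = unique-disjoint (subst Unique (trans eq (++-assoc as (v ∷ cs) ys)) equator-unique) u∈ (∈-++⁺ˡ x∈)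

    passed-not-outer : ∀ {f} → Passed f → f ≢ outer Q
    passed-not-outer ps refl = not-passed-after {xs = equator} {[]} (sym (++-identityʳ equator)) equator-walk
      (subst (v ∈_) (sym split-v) (∈-++⁺ʳ as (here refl))) ps

    module _ {i d} (t : T i d) where
      open Block (block i t)

      private
        walks : Walk 0F (outer Q) pre (near i d) × Walk 0F (outer Q) (pre ++ inside) (far i d)
        walks with walk-split pre (subst (λ l → Walk 0F (outer Q) l (outer Q)) split equator-walk)
        ... | f , w , rest with walk-split inside rest
        ...   | g , w′ , _ with walk-start w′ trace (λ eq → nowhere (subst (src d ∈_) eq (total here)))
          where
            nowhere : ∀ {x : Vtx} → x ∉ []
            nowhere ()
        ...     | refl = w , walk-++ w trace

        split′ : equator ≡ (pre ++ inside) ++ post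
        split′ = trans split (sym (++-assoc pre inside post))

      passed-near : Below i (src d) v → near i d ≢ outer Q → Passed (near i d)
      passed-near b = passed-before split (proj₁ walks) (∈-++⁺ˡ (total b))

      -- If `v` is not in the block of `d`, it comes before or after the whole block, so the faces
      -- at the two ends of the block are on the same side of `v`.
      both-passed : ¬ Below i (src d) v → (Passed (near i d) → far i d ≢ outer Q → Passed (far i d)) ×
                                          (Passed (far i d) → near i d ≢ outer Q → Passed (near i d))
      both-passed ¬b with ∈-++⁻ pre (subst (v ∈_) split (subst (v ∈_) (sym split-v) (∈-++⁺ʳ as (here refl))))
      ... | inj₁ v∈ = (λ ps → ⊥-elim (not-passed-after split (proj₁ walks) v∈ ps)) ,
                      (λ ps → ⊥-elim (not-passed-after split′ (proj₂ walks) (∈-++⁺ˡ v∈) ps))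
      ... | inj₂ v∈ with ∈-++⁻ inside v∈
      ...   | inj₁ v∈inside = ⊥-elim (¬b (sound v∈inside))
      ...   | inj₂ v∈post = (λ _ → passed-before split′ (proj₂ walks) v∈post) ,
                            (λ _ → passed-before split (proj₁ walks) v∈)

      endmost⇒¬below : endmost i (black d) ≡ true → src d ∈ as → ¬ Below i (src d) v
      endmost⇒¬below last u∈ b with subst (λ c → Extreme c (src d) inside) last extreme
      ... | us , eq with ∈-++⁻ us (subst (v ∈_) eq (total b))
      ...   | inj₂ (here refl) = unique-disjoint uniq u∈ (here refl)
      ...   | inj₁ v∈us = absurd (prefix-after uniq′ (trans (sym regroup) split-v) (∈-++⁺ʳ pre v∈us))
        where
          regroup : equator ≡ (pre ++ us) ++ src d ∷ post
          regroup = trans split (trans (cong (λ l → pre ++ l ++ post) eq)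
            (trans (cong (pre ++_) (++-assoc us [ src d ] post)) (sym (++-assoc pre us (src d ∷ post)))))

          uniq′ : Unique ((pre ++ us) ++ src d ∷ post)
          uniq′ = subst Unique regroup equator-unique

          absurd : (∃ λ cs → pre ++ us ≡ as ++ v ∷ cs) → ⊥
          absurd (cs , eq′) = unique-disjoint uniq′ (subst (src d ∈_) (sym eq′) (∈-++⁺ˡ u∈)) (here refl)

    off-path : ∀ {i d} → T i d → d ∉ path i → ¬ Below i (src d) v
    off-path {i} t d∉ b = d∉ (path-total (is-path i) t b)

    passed-across : ∀ {i d} → T i d → d ∉ path i →
      (Passed (fc d) → fc (rev d) ≢ outer Q → Passed (fc (rev d))) ×
      (Passed (fc (rev d)) → fc d ≢ outer Q → Passed (fc d))
    passed-across {zero} t d∉ = both-passed t (off-path t d∉)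
    passed-across {suc zero} t d∉ = proj₂ crossing , proj₁ crossing
      where crossing = both-passed t (off-path t d∉)

    -- Both kinds of seeds are near faces of blocks that contain `v`: `near` is the right side of a
    -- dart of `T 1F` and the left side of one of `T 0F`.
    reached⇒passed : ∀ {e} → Reached e → Passed (fc e)
    reached⇒passed (seed₁ d∈ ne) with path-sound path₁ d∈
    ... | t , b = passed-near t b ne
    reached⇒passed (seed₀ d∈ ne) with path-sound path₀ d∈
    ... | t , b = passed-near t b ne
    reached⇒passed (walk {e} r) = subst Passed (sym (face-φ G e)) (reached⇒passed r)
    reached⇒passed (cross {e} r ¬on ne) with coloured e
    ... | zero , inj₁ t = proj₁ (passed-across t (λ x → ¬on (inj₁ x))) (reached⇒passed r) ne
    ... | suc zero , inj₁ t = proj₁ (passed-across t (λ x → ¬on (inj₂ (inj₁ x)))) (reached⇒passed r) ne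
    ... | zero , inj₂ t = proj₂ (passed-across t (λ x → ¬on (inj₂ (inj₂ (inj₁ x)))))
                            (subst (λ x → Passed (fc x)) (sym (α-invol G e)) (reached⇒passed r)) ne
    ... | suc zero , inj₂ t = proj₂ (passed-across t (λ x → ¬on (inj₂ (inj₂ (inj₂ x)))))
                            (subst (λ x → Passed (fc x)) (sym (α-invol G e)) (reached⇒passed r)) ne

    reached-face : ∀ {e e′} → Reached e → fc e ≡ fc e′ → Reached e′
    reached-face {e} {e′} r eq with face-orbit G e e′ eq
    ... | n , refl = iter-pres nxt Reached walk n r

    reached-rot : ∀ {e} → Reached e → ¬ OnPaths Q L p₀ p₁ (rot e) → fc (rot e) ≢ outer Q → Reached (rot e)
    reached-rot {e} r ¬on ne = subst Reached (α-invol G (rot e))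
      (cross (walk r) ¬on′ (λ eq → ne (trans (cong fc (sym (α-invol G (rot e)))) eq)))
      where
        ¬on′ : ¬ OnPaths Q L p₀ p₁ (nxt e)
        ¬on′ (inj₁ x) = ¬on (inj₂ (inj₂ (inj₁ x)))
        ¬on′ (inj₂ (inj₁ x)) = ¬on (inj₂ (inj₂ (inj₂ x)))
        ¬on′ (inj₂ (inj₂ (inj₁ x))) = ¬on (inj₁ (subst (_∈ p₀) (α-invol G (rot e)) x))
        ¬on′ (inj₂ (inj₂ (inj₂ x))) = ¬on (inj₂ (inj₁ (subst (_∈ p₁) (α-invol G (rot e)) x)))

    reached-unrot : ∀ {e} → Reached (rot e) → ¬ OnPaths Q L p₀ p₁ (rot e) → fc e ≢ outer Q → Reached e
    reached-unrot {e} r ¬on ne = reached-face (cross r ¬on (λ eq → ne (trans (sym (face-φ G e)) eq))) (face-φ G e)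

    -- The edge of `x` has colour `i`, so only the path of that colour could use it, and in either
    -- direction it would pass through `src x`, making `v` a descendant.
    spoke-off-paths : ∀ {i x} → T i x ⊎ T i (rev x) → ¬ Below i (src x) v → ¬ OnPaths Q L p₀ p₁ x
    spoke-off-paths {i} {x} spoke ¬b = off
      where
        out : ∀ {j} → T j x × Below j (src x) v → ⊥
        out {j} (t′ , b) = go spoke
          where
            go : T i x ⊎ T i (rev x) → ⊥
            go (inj₁ t) = ¬b (subst (λ k → Below k (src x) v) (sym (T-colour {i} {j} {x} t t′)) b)
            go (inj₂ t) = T-one-way t′ t

        into : ∀ {j} → T j (rev x) × Below j (tgt x) v → ⊥
        into {j} (t′ , b) = go spoke
          where
            go : T i x ⊎ T i (rev x) → ⊥
            go (inj₁ t) = T-one-way t t′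
            go (inj₂ t) = ¬b (subst (λ k → Below k (src x) v) (sym (T-colour {i} {j} {rev x} t t′))
              (below-trans (up t′ (subst (Below j (src x)) (cong src (sym (α-invol G x))) here)) b))

        off : ¬ OnPaths Q L p₀ p₁ x
        off (inj₁ x∈) = out (path-sound path₀ x∈)
        off (inj₂ (inj₁ x∈)) = out (path-sound path₁ x∈)
        off (inj₂ (inj₂ (inj₁ x∈))) = into (path-sound path₀ x∈)
        off (inj₂ (inj₂ (inj₂ x∈))) = into (path-sound path₁ x∈)

    -- To go back from the face after u to the face before u, rotate about u on the side of the colour i
    -- in whose order u comes last among its descendants: no dart met there lies on a path from v.
    module _ {u g g′} (u∈ : u ∈ as) (h : Hit 1F u g) (ne : g ≢ outer Q) (h′ : Hit 0F u g′) (ne′ : g′ ≢ outer Q) where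

      private
        inner : ∀ {x} → src x ≡ u → fc x ≢ outer Q
        inner refl = angle-not-outer h ne h′ ne′

        off : ∀ {i d x} → T i d → src d ≡ u → endmost i (col Q u) ≡ true → src x ≡ u →
              T i x ⊎ T i (rev x) → ¬ OnPaths Q L p₀ p₁ x
        off {i} t refl last at spoke = spoke-off-paths spoke
          (subst (λ y → ¬ Below i y v) (sym at) (endmost⇒¬below t last u∈))

      back-black : Run 0F u → col Q u ≡ true → R₁Face Q L p₀ p₁ g′ → R₁Face Q L p₀ p₁ g
      back-black R bu (e , eq , r) = _ , end-face h , ascend len ≤-refl
        where
          open Run R

          out : T 0F first
          out = subst (λ c → T (oppIf (not c) 0F) first) (trans (cong (col Q) at) bu) (Turn⇒T first-turn)

          start-face : Hit 0F u g′ → g′ ≡ fc (rev first)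
          start-face (d , at′ , t , eq′) with Turn-unique (trans at′ (sym at)) t first-turn
          ... | refl = trans (sym eq′) (side-black (trans (cong (col Q) at) bu))

          end-face : Hit 1F u g → fc ((rot ^[ len ]) first) ≡ g
          end-face (d , at′ , t , eq′) with Turn-unique (trans at′ (sym (src-at (suc len)))) t last-turn
          ... | refl = trans (sym (face-φ G _)) (trans (sym (side-black (trans (cong (col Q) at′) bu))) eq′)

          off-sector : ∀ {x} → src x ≡ u → T 0F x ⊎ T 0F (rev x) → ¬ OnPaths Q L p₀ p₁ x
          off-sector = off out at bu

          ascend : ∀ t → t ≤ len → Reached ((rot ^[ t ]) first)
          -- The face `g′` is to the right of `first`, so the rotation begins by crossing the
          -- out-dart `first` itself.
          ascend zero _ = subst Reached (σσ⁻ G first) (reached-rot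
            (reached-face r (trans eq (trans (start-face h′) (sym (fc-rot⁻ first)))))
            (subst (λ x → ¬ OnPaths Q L p₀ p₁ x) (sym (σσ⁻ G first)) (off-sector at (inj₁ out)))
            (inner (trans (cong src (σσ⁻ G first)) at)))
          ascend (suc t) le = reached-rot (ascend t (<⇒≤ le))
            (off-sector (src-at (suc t)) (inj₂ (sector-child first t (during t (<⇒≤ le)) (during (suc t) le))))
            (inner (src-at (suc t)))

      back-white : Run 1F u → col Q u ≡ false → R₁Face Q L p₀ p₁ g′ → R₁Face Q L p₀ p₁ g
      back-white R wu (e , eq , r) = first , end-face h , descend (suc len) ≤-refl (reached-face r (trans eq (start-face h′)))
        where
          open Run R

          out : T 1F ((rot ^[ suc len ]) first)
          out = subst (λ c → T (oppIf (not c) 0F) ((rot ^[ suc len ]) first)) (trans (cong (col Q) (src-at (suc len))) wu) (Turn⇒T last-turn)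

          start-face : Hit 0F u g′ → g′ ≡ fc ((rot ^[ suc len ]) first)
          start-face (d , at′ , t , eq′) with Turn-unique (trans at′ (sym (src-at (suc len)))) t last-turn
          ... | refl = trans (sym eq′) (side-white (trans (cong (col Q) at′) wu))

          end-face : Hit 1F u g → fc first ≡ g
          end-face (d , at′ , t , eq′) with Turn-unique (trans at′ (sym at)) t first-turn
          ... | refl = trans (sym (side-white (trans (cong (col Q) at) wu))) eq′

          spoke : ∀ t → t ≤ len → T 1F ((rot ^[ suc t ]) first) ⊎ T 1F (rev ((rot ^[ suc t ]) first))
          spoke t le with m≤n⇒m<n∨m≡n le
          ... | inj₁ lt = inj₂ (sector-child first t (during t le) (during (suc t) lt))
          ... | inj₂ refl = inj₁ out

          descend : ∀ t → t ≤ suc len → Reached ((rot ^[ t ]) first) → Reached first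
          descend zero _ r = r
          descend (suc t) (s≤s le) r = descend t (≤-trans le (n≤1+n len)) (reached-unrot r
            (off out (src-at (suc len)) (cong not wu) (src-at (suc t)) (spoke t le))
            (inner (src-at t)))

      back : R₁Face Q L p₀ p₁ g′ → R₁Face Q L p₀ p₁ g
      back r with col Q u in eq
      ... | true = back-black (run-at 0F u (Hit-inner h)) eq r
      ... | false = back-white (run-at 1F u (Hit-inner h)) eq r

    -- The dart with `Turn 1F` at `v` starts P₁ if `v` is black and P₀ if `v` is white; its `side`
    -- is then on the right or on the left, which is the seeded side.
    adjacent-reached : ∀ {g} → Hit 1F v g → g ≢ outer Q → R₁Face Q L p₀ p₁ g
    adjacent-reached (d , refl , t , refl) ne with col Q (src d) in eq
    ... | true = _ , refl , seed₁ (path-total path₁ (subst (λ c → T (oppIf (not c) 1F) d) eq (Turn⇒T t)) here) ne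
    ... | false = _ , refl , seed₀ (path-total path₀ (subst (λ c → T (oppIf (not c) 1F) d) eq (Turn⇒T t)) here) ne

    -- Induction on the stretch `ds` of the equator between the face `g` and `v`; it is empty at the
    -- seed and grows by one `back` at a time.
    equator-reached : ∀ cs ds {g} → as ≡ cs ++ ds → Walk 0F (outer Q) cs g → g ≢ outer Q → R₁Face Q L p₀ p₁ g
    equator-reached cs ds {g} eq w ne = go ds eq (walk-split cs (subst (λ l → Walk 0F (outer Q) l (outer Q)) regroup equator-walk))
      where
        regroup : equator ≡ cs ++ ds ++ v ∷ bs
        regroup = trans split-v (trans (cong (_++ v ∷ bs) eq) (++-assoc cs ds (v ∷ bs)))

        go : ∀ ds → as ≡ cs ++ ds → (∃ λ f → Walk 0F (outer Q) cs f × Walk 0F f (ds ++ v ∷ bs) (outer Q)) → R₁Face Q L p₀ p₁ g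
        go [] _ (f , w′ , pass a _ _) = adjacent-reached (subst (Hit 1F v) (walk-end w′ w) a) ne
        go (u ∷ ds) eq (f , w′ , pass a b _) with walk-end w′ w
        ... | refl = back u∈ a ne b ne′ (equator-reached (cs ∷ʳ u) ds (trans eq (sym (++-assoc cs [ u ] ds)))
                       (walk-++ w (pass a b stop)) ne′)
          where
            u∈ : u ∈ as
            u∈ = subst (u ∈_) (sym eq) (∈-++⁺ʳ cs (here refl))
            ne′ = passed-not-outer (u , u∈ , b)

    passed⇒reached : ∀ {f} → Passed f → R₁Face Q L p₀ p₁ f
    passed⇒reached ps@(u , u∈ , hit) with ∈-∃++ u∈
    ... | cs , ds , eq with walk-split cs (subst (λ l → Walk 0F (outer Q) l (outer Q))
            (trans split-v (trans (cong (_++ v ∷ bs) eq) (++-assoc cs (u ∷ ds) (v ∷ bs)))) equator-walk)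
    ...   | f , w , pass a b _ with Hit-face hit b
    ...     | refl = equator-reached (cs ∷ʳ u) ds (trans eq (sym (++-assoc cs [ u ] ds))) (walk-++ w (pass a b stop)) (passed-not-outer ps)

    count : ∀ {k} → HasCount Q L (R₁Face Q L p₀ p₁) k → k ≡ length as
    count (fs , uf , sound , total , refl) with walk-split as (subst (λ l → Walk 0F (outer Q) l (outer Q)) split-v equator-walk)
    ... | _ , w , _ = trans (unique-length uf (walk-faces-unique w (unique-prefix as uniq))
            (λ f∈ → let (e , eq , r) = sound _ f∈ ; (u , u∈ , hit) = subst Passed eq (reached⇒passed r) in walk-faces-total w u∈ hit)
            (λ f∈ → total _ (passed⇒reached (walk-faces-sound w f∈))))
          (walk-faces-length w)

  -- The order of the vertices

  order : List Vtx
  order = root 1F ∷ equator ++ [ root 0F ]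

  rank : Vtx → ℕ
  rank = position order

  roots-distinct : ∀ {i j} → root i ≡ root j → i ≡ j
  roots-distinct {i} {j} eq = trans (sym (lab-root i (src-angle i))) (lab-root j (trans (src-angle i) eq))

  root∉equator : ∀ i → root i ∉ equator
  root∉equator i r∈ = walk-inner equator-walk r∈ i refl

  order-complete : ∀ v → v ∈ order
  order-complete v with placed v
  ... | inj₁ (zero , eq) = there (∈-++⁺ʳ equator (here eq))
  ... | inj₁ (suc zero , eq) = here eq
  ... | inj₂ v∈ = there (∈-++⁺ˡ v∈)

  root₁-fresh : root 1F ∉ equator ++ [ root 0F ]
  root₁-fresh r∈ with ∈-++⁻ equator r∈
  ... | inj₁ r∈′ = root∉equator 1F r∈′
  ... | inj₂ (here eq) with roots-distinct {1F} {0F} eq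
  ...   | ()

  order-unique : Unique order
  order-unique = tabulate (λ w∈ eq → root₁-fresh (subst (_∈ equator ++ [ root 0F ]) (sym eq) w∈)) ∷
    Unique.++⁺ equator-unique ([] ∷ []) (λ { (w∈ , here refl) → root∉equator 0F w∈ })

  order-length : length order ≡ nV G
  order-length = trans (unique-length order-unique (Unique.allFin⁺ (nV G)) (λ _ → ∈-allFin _) (λ _ → order-complete _))
    (length-tabulate (λ v → v))

  rank-injective : ∀ {u v} → rank u ≡ rank v → u ≡ v
  rank-injective = position-injective order (order-complete _) (order-complete _)

  -- Descendants as intervals of the order.

  record Interval (i : Fin 2) (u : Vtx) : Set where
    field
      pre inside post : List Vtx
      split : order ≡ pre ++ inside ++ post
      sound : ∀ {w} → w ∈ inside → Below i u w
      total : ∀ {w} → Below i u w → w ∈ inside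
      extreme : Extreme (endmost i (col Q u)) u inside

    private
      uniq : Unique (pre ++ inside ++ post)
      uniq = subst Unique split order-unique

      rank-eq : ∀ w → rank w ≡ position (pre ++ inside ++ post) w
      rank-eq w = cong (λ l → position l w) split

      pre-disjoint : ∀ {w} → w ∈ inside → w ∉ pre
      pre-disjoint w∈ w∈pre = unique-disjoint uniq w∈pre (∈-++⁺ˡ w∈)

      rank-inside : ∀ {w} → w ∈ inside → rank w ≡ length pre + position (inside ++ post) w
      rank-inside w∈ = trans (rank-eq _) (position-++ʳ pre (pre-disjoint w∈))

      rank-≥ : ∀ {w} → w ∈ inside → length pre ≤ rank w
      rank-≥ w∈ = subst (length pre ≤_) (sym (rank-inside w∈)) (m≤m+n (length pre) _)

      rank-< : ∀ {w} → w ∈ inside → rank w < length pre + length inside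
      rank-< w∈ = subst (_< length pre + length inside) (sym (rank-inside w∈)) (+-monoʳ-< (length pre) (position-++ˡ inside w∈))

    convex : ∀ {x y z} → Below i u x → Below i u y → rank x ≤ rank z → rank z ≤ rank y → Below i u z
    convex {x} {y} {z} bx by x≤z z≤y = sound z∈inside
      where
        z∉pre : z ∉ pre
        z∉pre z∈ = ≤⇒≯ (≤-trans (rank-≥ (total bx)) x≤z) (subst (_< length pre) (sym (rank-eq z)) (position-++ˡ pre z∈))

        z∈inside : z ∈ inside
        z∈inside with position-++ʳ pre {inside ++ post} z∉pre | ∈-++⁻ pre (subst (z ∈_) split (order-complete z))
        ... | _ | inj₁ z∈ = ⊥-elim (z∉pre z∈)
        ... | eq | inj₂ z∈ with ∈-++⁻ inside z∈
        ...   | inj₁ z∈′ = z∈′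
        ...   | inj₂ z∈post = ⊥-elim (≤⇒≯ beyond (≤-<-trans z≤y (rank-< (total by))))
          where
            z∉inside : z ∉ inside
            z∉inside z∈′ = unique-disjoint (subst Unique (sym (++-assoc pre inside post)) uniq) (∈-++⁺ʳ pre z∈′) z∈post

            beyond : length pre + length inside ≤ rank z
            beyond = subst (length pre + length inside ≤_) (sym (trans (rank-eq z) (trans eq (cong (length pre +_) (position-++ʳ inside z∉inside)))))
              (+-monoʳ-≤ (length pre) (m≤m+n (length inside) _))

    upper : endmost i (col Q u) ≡ true → ∀ {x} → Below i u x → rank x ≤ rank u
    upper last b with subst (λ c → Extreme c u inside) last extreme
    ... | us , eq with ∈-++⁻ us (subst (_ ∈_) eq (total b))
    ...   | inj₂ (here refl) = ≤-refl
    ...   | inj₁ x∈us = <⇒≤ (<-≤-trans (at (position-++ˡ (pre ++ us) (∈-++⁺ʳ pre x∈us)))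
              (subst (length (pre ++ us) ≤_) (sym (trans (cong (λ l → position l u) regroup) (position-++ʳ (pre ++ us) u∉))) (m≤m+n _ _)))
      where
        regroup : order ≡ (pre ++ us) ++ u ∷ post
        regroup = trans split (trans (cong (λ l → pre ++ l ++ post) eq)
          (trans (cong (pre ++_) (++-assoc us [ u ] post)) (sym (++-assoc pre us (u ∷ post)))))

        at : ∀ {w m} → position ((pre ++ us) ++ u ∷ post) w < m → rank w < m
        at {w} = subst (_< _) (sym (cong (λ l → position l w) regroup))

        u∉ : u ∉ pre ++ us
        u∉ u∈ = unique-disjoint (subst Unique regroup order-unique) u∈ (here refl)

    lower : endmost i (col Q u) ≡ false → ∀ {x} → Below i u x → rank u ≤ rank x
    lower first b with subst (λ c → Extreme c u inside) first extreme
    ... | us , eq = subst (_≤ rank _) (sym rank-u) (rank-≥ (total b))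
      where
        rank-u : rank u ≡ length pre
        rank-u = trans (rank-eq u) (trans (cong (λ l → position (pre ++ l ++ post) u) eq)
          (position-middle pre (pre-disjoint (total here))))

  root-interval : ∀ i → Interval i (root i)
  root-interval zero = record
    { pre = [ root 1F ] ; inside = equator ∷ʳ root 0F ; post = []
    ; split = cong (root 1F ∷_) (sym (++-identityʳ (equator ∷ʳ root 0F)))
    ; sound = snd ; total = tot
    ; extreme = subst (λ c → Extreme c (root 0F) (equator ∷ʳ root 0F)) (sym (black-root 0F)) (equator , refl) }
    where
      snd : ∀ {w} → w ∈ equator ∷ʳ root 0F → Below 0F (root 0F) w
      snd w∈ with ∈-++⁻ equator w∈
      ... | inj₁ w∈′ = equator⇒below 0F w∈′
      ... | inj₂ (here refl) = here

      tot : ∀ {w} → Below 0F (root 0F) w → w ∈ equator ∷ʳ root 0F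
      tot b with below⇒equator 0F b
      ... | inj₁ eq = ∈-++⁺ʳ equator (here eq)
      ... | inj₂ w∈ = ∈-++⁺ˡ w∈
  root-interval (suc zero) = record
    { pre = [] ; inside = root 1F ∷ equator ; post = [ root 0F ]
    ; split = refl
    ; sound = snd ; total = tot
    ; extreme = subst (λ c → Extreme (not c) (root 1F) (root 1F ∷ equator)) (sym (black-root 1F)) (equator , refl) }
    where
      snd : ∀ {w} → w ∈ root 1F ∷ equator → Below 1F (root 1F) w
      snd (here refl) = here
      snd (there w∈) = equator⇒below 1F w∈

      tot : ∀ {w} → Below 1F (root 1F) w → w ∈ root 1F ∷ equator
      tot b with below⇒equator 1F b
      ... | inj₁ eq = here eq
      ... | inj₂ w∈ = there w∈

  block-interval : ∀ {i d} → Block i d → Interval i (src d)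
  block-interval B = record
    { pre = root 1F ∷ pre ; inside = inside ; post = post ∷ʳ root 0F
    ; split = cong (root 1F ∷_) (trans (cong (_∷ʳ root 0F) split) (trans (++-assoc pre (inside ++ post) [ root 0F ])
        (cong (pre ++_) (++-assoc inside post [ root 0F ]))))
    ; sound = sound ; total = total ; extreme = extreme }
    where open Block B

  interval : ∀ i u → u ≢ root (opp i) → Interval i u
  interval i u ne with below-root i ne
  ... | here = root-interval i
  ... | up t _ = block-interval (block i t)

  endmost-not : ∀ i b → endmost i (not b) ≡ not (endmost i b)
  endmost-not zero b = refl
  endmost-not (suc zero) b = refl

  -- Positions of the two ends of a tree edge.

  Parent : Fin 2 → Vtx → Vtx → Set
  Parent i u p = ∃ λ d → T i d × src d ≡ u × tgt d ≡ p

  edge-parent : ∀ {i d} → EdgeT Q L i d → Parent i (src d) (tgt d) ⊎ Parent i (tgt d) (src d)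
  edge-parent (inj₁ t) = inj₁ (_ , t , refl , refl)
  edge-parent (inj₂ t) = inj₂ (_ , t , refl , cong src (α-invol G _))

  parent-extend : ∀ {i u p w} → Parent i u p → Below i w p → Below i w u
  parent-extend (_ , t , refl , refl) b = up t b

  parent-below : ∀ {i u p w} → Parent i u p → Below i w u → u ≢ w → Below i w p
  parent-below (_ , t , refl , refl) b ne with below-parent t b
  ... | inj₁ eq = ⊥-elim (ne eq)
  ... | inj₂ b′ = b′

  parent-interval : ∀ {i u p} → Parent i u p → Interval i p
  parent-interval {i} (d , t , _ , refl) = interval i _ (λ eq → opp-≢ i (T-tgt-root {i} {opp i} {d} t eq))

  edge-endmost : ∀ i d → endmost i (col Q (tgt d)) ≡ not (endmost i (black d))
  edge-endmost i d = trans (cong (endmost i) (black-rev d)) (endmost-not i (black d))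

  -- The ends have different colours, so one of them comes last and the other first among its
  -- descendants. A parent of the first kind is to the right of its child, one of the second kind to
  -- the left; either way the right end is of the first kind.
  edge-ends : ∀ {i d} → EdgeT Q L i d → rank (src d) < rank (tgt d) →
    endmost i (black d) ≡ false × endmost i (col Q (tgt d)) ≡ true
  edge-ends {i} {d} edge lt = decide (endmost i (black d)) refl (edge-parent edge)
    where
      decide : ∀ b → endmost i (black d) ≡ b → Parent i (src d) (tgt d) ⊎ Parent i (tgt d) (src d) →
        endmost i (black d) ≡ false × endmost i (col Q (tgt d)) ≡ true
      decide false eq _ = eq , trans (edge-endmost i d) (cong not eq)
      decide true eq (inj₁ par) = ⊥-elim (≤⇒≯
        (Interval.lower (parent-interval par) (trans (edge-endmost i d) (cong not eq)) (parent-extend par here)) lt)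
      decide true eq (inj₂ par) = ⊥-elim (≤⇒≯ (Interval.upper (parent-interval par) eq (parent-extend par here)) lt)

  rank-≢ : ∀ {u v} → rank u < rank v → u ≢ v
  rank-≢ lt refl = <-irrefl refl lt

  no-crossing : ∀ {i a b c d} → rank a < rank b → rank b < rank c → rank c < rank d →
    endmost i (col Q a) ≡ false → endmost i (col Q b) ≡ false →
    endmost i (col Q c) ≡ true → endmost i (col Q d) ≡ true →
    Parent i a c ⊎ Parent i c a → Parent i b d ⊎ Parent i d b → ⊥
  no-crossing {i} {a} {b} {c} {d} ab bc cd Ha Hb Hc Hd = cases
    where
      cases : Parent i a c ⊎ Parent i c a → Parent i b d ⊎ Parent i d b → ⊥
      -- Here `c` is the parent of `a`, so `b`, lying between them, is below `c`. Then so is `d`, as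
      -- parent or child of `b`, although `c` comes last among its descendants.
      cases (inj₁ ac) e = ≤⇒≯ (C.upper Hc (d∈c e)) cd
        where
          module C = Interval (parent-interval ac)
          b∈c : Below i c b
          b∈c = C.convex (parent-extend ac here) here (<⇒≤ ab) (<⇒≤ bc)
          d∈c : Parent i b d ⊎ Parent i d b → Below i c d
          d∈c (inj₁ bd) = parent-below bd b∈c (rank-≢ bc)
          d∈c (inj₂ db) = parent-extend db b∈c
      -- Here `c` lies between `b` and its child `d`, so `a`, the parent of `c`, is below `b`,
      -- although `b` comes first among its descendants.
      cases (inj₂ ca) (inj₂ db) = ≤⇒≯ (B.lower Hb a∈b) ab
        where
          module B = Interval (parent-interval db)
          a∈b : Below i b a
          a∈b = parent-below ca (B.convex here (parent-extend db here) (<⇒≤ bc) (<⇒≤ cd)) (λ eq → rank-≢ bc (sym eq))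
      -- With the parents at the outer ends, `a` and `d` would each be below the other.
      cases (inj₂ ca) (inj₁ bd) = rank-≢ (<-trans ab (<-trans bc cd)) (below-antisym depth d∈a a∈d)
        where
          module A = Interval (parent-interval ca)
          module D = Interval (parent-interval bd)
          d∈a : Below i a d
          d∈a = parent-below bd (A.convex here (parent-extend ca here) (<⇒≤ ab) (<⇒≤ bc)) (λ eq → rank-≢ ab (sym eq))
          a∈d : Below i d a
          a∈d = parent-below ca (D.convex (parent-extend bd here) here (<⇒≤ bc) (<⇒≤ cd)) (rank-≢ cd)
          depth : Depth i _ a
          depth = proj₂ (below-root⇒depth (below-root i (λ eq → opp-≢ i (T-tgt-root {i} {opp i} {proj₁ ca}
                    (proj₁ (proj₂ ca)) (trans (proj₂ (proj₂ (proj₂ ca))) eq)))))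

  module _ (f₁ : Vtx → ℤ) (isF₁ : IsF₁ Q L f₁) where

    -- For inner `v` the rank exceeds the number of equator vertices before `v` by one, because `s₁`
    -- comes first. `IsF₁` speaks about given paths, so the paths from `v` have to be produced
    -- before it yields a value.
    f₁-rank : ∀ v → f₁ v ≡ predℤ (rank v)
    f₁-rank v with placed v
    ... | inj₁ (suc zero , refl) = trans (proj₁ (proj₂ isF₁)) (cong predℤ (sym (position-here {v = root 1F})))
    ... | inj₁ (zero , refl) = trans (proj₁ isF₁) (sym (trans (cong predℤ (position-middle (root 1F ∷ equator) fresh)) (cong (λ n → ℤ.+ (n ∸ 2)) count-all)))
      where
        fresh : root 0F ∉ root 1F ∷ equator
        fresh r∈ = unique-disjoint {xs = root 1F ∷ equator} order-unique r∈ (here refl)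

        count-all : suc (suc (length equator)) ≡ nV G
        count-all = trans (cong suc (trans (+-comm 1 _) (sym (length-++ equator)))) order-length
    ... | inj₂ v∈ with ∈-∃++ v∈
    ...   | as , bs , eq = trans f₁-length (cong predℤ (sym rank-v))
      where
        inner : ∀ j → v ≢ root j
        inner = walk-inner equator-walk v∈

        regroup : order ≡ (root 1F ∷ as) ++ v ∷ bs ∷ʳ root 0F
        regroup = cong (root 1F ∷_) (trans (cong (_∷ʳ root 0F) eq) (++-assoc as (v ∷ bs) [ root 0F ]))

        rank-v : rank v ≡ suc (length as)
        rank-v = trans (cong (λ l → position l v) regroup)
          (position-middle (root 1F ∷ as) (λ v∈′ → unique-disjoint (subst Unique regroup order-unique) v∈′ (here refl)))

        path : ∀ i → ∃ λ p → PathT Q L i v p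
        path i = path-exists (equator⇒below i v∈)

        f₁-length : f₁ v ≡ ℤ.+ length as
        f₁-length with proj₂ (proj₂ isF₁) v (inner 0F) (inner 1F) _ _ (proj₂ (path 0F)) (proj₂ (path 1F))
        ... | k , counted , f₁-k = trans f₁-k (cong ℤ.+_ (Region.count eq (proj₂ (path 0F)) (proj₂ (path 1F)) counted))

    f₁-cancel-< : ∀ {u v} → f₁ u ℤ.< f₁ v → rank u < rank v
    f₁-cancel-< {u} {v} lt = predℤ-cancel-< (subst₂ ℤ._<_ (f₁-rank u) (f₁-rank v) lt)

    f₁-injective : ∀ u v → f₁ u ≡ f₁ v → u ≡ v
    f₁-injective u v eq = rank-injective (predℤ-injective (trans (sym (f₁-rank u)) (trans eq (f₁-rank v))))

    non-crossing : ∀ i → NonCrossing Q L f₁ i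
    non-crossing i d d′ e e′ (lt₁ , lt₂ , lt₃) =
      no-crossing ab bc cd (proj₁ ends) (proj₁ ends′) (proj₂ ends) (proj₂ ends′) (edge-parent e) (edge-parent e′)
      where
        ab = f₁-cancel-< lt₁
        bc = f₁-cancel-< lt₂
        cd = f₁-cancel-< lt₃
        ends = edge-ends e (<-trans ab bc)
        ends′ = edge-ends e′ (<-trans bc cd)

    alternating : ∀ i → Alternating Q L f₁ i
    alternating i d d′ e e′ meet (lt₁ , lt₂)
      with trans (sym (proj₂ (edge-ends e (subst (λ x → rank (src d) < rank x) (sym meet) (f₁-cancel-< lt₁)))))
                 (trans (cong (λ x → endmost i (col Q x)) meet) (proj₁ (edge-ends e′ (f₁-cancel-< lt₂))))
    ... | ()

theorem3 : (Q : Quadrangulation) (L : StrongLabeling Q) (f₁ : Fin (nV (M Q)) → ℤ) →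
    IsF₁ Q L f₁ →
    (∀ u v → f₁ u ≡ f₁ v → u ≡ v) ×
    (∀ i → NonCrossing Q L f₁ i × Alternating Q L f₁ i)
theorem3 Q L f₁ isF₁ = Labeled.f₁-injective Q L f₁ isF₁ , λ i → Labeled.non-crossing Q L f₁ isF₁ i , Labeled.alternating Q L f₁ isF₁ i
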